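{- For every $C,D\in\mathbb{B}^{\ell\times m}$, there exists a Presburger formula $\textsf{REG}_{C,D}(\bar X)$ with $\bar X=(X_1,\dots,X_m)$ such that for all $\bar N\in\mathbb{N}^m$: there exists a $(C,D)$-regular-digraph of size $\bar N$ if and only if $\textsf{REG}_{C,D}(\bar N)$ holds.
   Context: A Presburger formula is a first-order formula with $+,\le,0,1$ interpreted over $\mathbb{N}=\{0,1,2,\dots\}$. Let $\mathbb{B}=\mathbb{N}\cup\{{\ge}d\mid d\in\mathbb{N}\}$, where "$x={\ge}d$" means $x\ge d$. An $\ell$-type digraph is $G=(V,E_1,\dots,E_\ell)$ where $E_1,\dots,E_\ell$ are pairwise disjoint irreflexive binary relations on $V$ such that for all $u,v$, if $(u,v)\in E_1\cup\dots\cup E_\ell$ then $(v,u)\notin E_1\cup\dots\cup E_\ell$. $\textrm{in-deg}_{E_i}(v)$ and $\textrm{out-deg}_{E_i}(v)$ are the numbers of incoming and outgoing $E_i$-edges of $v$. For $C,D\in\mathbb{B}^{\ell\times m}$, $G$ is a $(C,D)$-regular-digraph if there is a partition $V=V_1\cup\dots\cup V_m$ (parts may be empty) such that for all $i\le\ell$, $j\le m$ and $v\in V_j$: $\textrm{in-deg}_{E_i}(v)=C_{i,j}$ and $\textrm{out-deg}_{E_i}(v)=D_{i,j}$; it has size $\bar N$ if the partition can be chosen with $\bar N=(|V_1|,\dots,|V_m|)$. -}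

module Defs where

open import Data.Nat using (ℕ; zero; suc; _+_; _≤_)
open import Data.Fin using (Fin; zero; suc; _≟_)
open import Data.Bool using (Bool; true; false; if_then_else_)
open import Data.Product using (Σ; _×_; ∃)
open import Data.Sum using (_⊎_)
open import Data.Empty using (⊥)
open import Relation.Nullary using (¬_)
open import Relation.Nullary.Decidable using (⌊_⌋)
open import Relation.Binary.PropositionalEquality using (_≡_)

-- Presburger arithmetic: first-order formulas over (ℕ, +, ≤, 0, 1).
-- Free variables of a formula with n free variables are indexed by Fin n
-- (de Bruijn: the variable bound by a quantifier is `zero`).

data Term (n : ℕ) : Set where
  var  : Fin n → Term n
  `0   : Term n
  `1   : Term n
  _⊕_  : Term n → Term n → Term n

data Formula (n : ℕ) : Set where
  _≤′_ : Term n → Term n → Formula n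
  _≡′_ : Term n → Term n → Formula n
  ⊤′ ⊥′ : Formula n
  ¬′_  : Formula n → Formula n
  _∧′_ _∨′_ _⇒′_ : Formula n → Formula n → Formula n
  ∃′ ∀′ : Formula (suc n) → Formula n

_∷ₑ_ : ∀ {n} → ℕ → (Fin n → ℕ) → Fin (suc n) → ℕ
(a ∷ₑ ρ) zero    = a
(a ∷ₑ ρ) (suc i) = ρ i

evalT : ∀ {n} → Term n → (Fin n → ℕ) → ℕ
evalT (var i) ρ = ρ i
evalT `0      ρ = 0
evalT `1      ρ = 1
evalT (s ⊕ t) ρ = evalT s ρ + evalT t ρ

⟦_⟧ : ∀ {n} → Formula n → (Fin n → ℕ) → Set
⟦ s ≤′ t ⟧ ρ = evalT s ρ ≤ evalT t ρ
⟦ s ≡′ t ⟧ ρ = evalT s ρ ≡ evalT t ρ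
⟦ ⊤′ ⟧ ρ = ⊥ → ⊥
⟦ ⊥′ ⟧ ρ = ⊥
⟦ ¬′ φ ⟧ ρ = ¬ ⟦ φ ⟧ ρ
⟦ φ ∧′ ψ ⟧ ρ = ⟦ φ ⟧ ρ × ⟦ ψ ⟧ ρ
⟦ φ ∨′ ψ ⟧ ρ = ⟦ φ ⟧ ρ ⊎ ⟦ ψ ⟧ ρ
⟦ φ ⇒′ ψ ⟧ ρ = ⟦ φ ⟧ ρ → ⟦ ψ ⟧ ρ
⟦ ∃′ φ ⟧ ρ = Σ ℕ (λ a → ⟦ φ ⟧ (a ∷ₑ ρ))
⟦ ∀′ φ ⟧ ρ = (a : ℕ) → ⟦ φ ⟧ (a ∷ₑ ρ)

data 𝔹 : Set where
  exactly : ℕ → 𝔹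
  atLeast : ℕ → 𝔹

_≐_ : ℕ → 𝔹 → Set
x ≐ exactly d = x ≡ d
x ≐ atLeast d = d ≤ x

count : (k : ℕ) → (Fin k → Bool) → ℕ
count zero    p = 0
count (suc k) p = (if p zero then 1 else 0) + count k (λ v → p (suc v))

-- ℓ-type digraphs on the finite vertex set Fin k.
-- E i u v = true  means (u , v) ∈ E_i.

record Digraph (ℓ k : ℕ) : Set where
  field
    E        : Fin ℓ → Fin k → Fin k → Bool
    irrefl   : ∀ i v → E i v v ≡ false
    disjoint : ∀ i i′ u v → E i u v ≡ true → E i′ u v ≡ true → i ≡ i′
    asym     : ∀ i i′ u v → E i u v ≡ true → E i′ v u ≡ false

module _ {ℓ k : ℕ} (G : Digraph ℓ k) where
  open Digraph G

  in-deg : Fin ℓ → Fin k → ℕ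
  in-deg i v = count k (λ u → E i u v)

  out-deg : Fin ℓ → Fin k → ℕ
  out-deg i v = count k (λ w → E i v w)

-- G is a (C,D)-regular digraph witnessed by the partition `part`
-- (vertex v lies in V_{part v}), of size N.
IsRegularOfSize : ∀ {ℓ m k} → (C D : Fin ℓ → Fin m → 𝔹) → (N : Fin m → ℕ)
                → Digraph ℓ k → Set
IsRegularOfSize {ℓ} {m} {k} C D N G =
  Σ (Fin k → Fin m) λ part →
      (∀ j → count k (λ v → ⌊ part v ≟ j ⌋) ≡ N j)
    × (∀ i v → in-deg G i v ≐ C i (part v))
    × (∀ i v → out-deg G i v ≐ D i (part v))

∃RegularOfSize : ∀ {ℓ m} → (C D : Fin ℓ → Fin m → 𝔹) → (N : Fin m → ℕ) → Set
∃RegularOfSize {ℓ} C D N = Σ ℕ λ k → Σ (Digraph ℓ k) λ G → IsRegularOfSize C D N G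

{-# OPTIONS --safe #-}
module Submission where

-- A slot is a colour together with a direction, and for each slot s there are two
-- kinds of vertices: those whose s-degree must be positive, and those whose s-degree
-- is not bounded above.
--
-- If every kind that occurs at all occurs often, a digraph exists exactly when, for
-- each slot s, the prescribed s-degrees sum to at most the prescribed degrees of the
-- reversed slot, or the latter are unbounded at some vertex.  This is a linear
-- condition.  For sufficiency, edges are first added greedily, switching with an
-- existing edge when the two ends with missing degree are already adjacent, until
-- each colour lacks degrees in at most one direction; the missing degrees are then
-- joined to vertices with unbounded reversed degree.
--
-- If some kind occurs, but rarely, its vertices are guessed and removed one at a
-- time.  Removing a vertex x splits each part according to the edge between x and
-- the vertices of the part, and lowers their requirements accordingly, so the parts
-- of the smaller problem are existentially quantified variables.  Once the kind has
-- disappeared it never comes back, so this recursion terminates.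

open import Defs
open import Data.Bool as Bool using (Bool; true; false; if_then_else_)
open import Data.Nat as ℕ using (ℕ; zero; suc; _+_; _*_; _∸_; _≤_; _<_; z≤n; s≤s; s≤s⁻¹; _≤?_; _<?_)
open import Data.Nat.Properties hiding (_≟_; suc-injective)
open import Data.Nat.Tactic.RingSolver using (solve-∀)
open import Data.Fin using (Fin; zero; suc; _≟_; _↑ˡ_; _↑ʳ_; combine; remQuot; punchIn; splitAt; join)
open import Data.Fin.Properties using (any?; suc-injective; punchInᵢ≢i; ↑ˡ-injective; combine-injectiveʳ; remQuot-combine; splitAt-↑ˡ; splitAt-↑ʳ; splitAt⁻¹-↑ˡ; splitAt⁻¹-↑ʳ; splitAt-join; join-splitAt)
open import Data.Maybe using (Maybe; just; nothing; map)
open import Data.Maybe.Properties using (just-injective)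
open import Data.Product using (Σ; _×_; _,_; proj₁; proj₂)
open import Data.Sum as Sum using (_⊎_; inj₁; inj₂; [_,_]′)
open import Data.Sum.Properties using (swap-involutive)
open import Data.Unit using (⊤; tt)
open import Data.Empty using (⊥-elim)
open import Function using (_∘_; id)
open import Function.Bundles using (_⇔_; mk⇔)
open import Relation.Nullary using (¬_; Dec; yes; no; contradiction; _×-dec_)
open import Relation.Nullary.Decidable using (⌊_⌋)
open import Relation.Binary.PropositionalEquality using (_≡_; _≢_; _≗_; refl; sym; trans; cong; cong₂; subst; module ≡-Reasoning)
open import Algebra.Properties.Semiring.Sum +-*-semiring using (sum; sum-cong-≗; sum-remove; ∑-distrib-+; ∑-comm; *-distribˡ-sum; *-distribʳ-sum)

private
  variable
    k m n : ℕ

-- Finite sums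

δ : Fin n → Fin n → ℕ
δ i j = if ⌊ i ≟ j ⌋ then 1 else 0

δ-refl : (i : Fin n) → δ i i ≡ 1
δ-refl i with i ≟ i
... | yes _ = refl
... | no i≢i = contradiction refl i≢i

δ-≢ : {i j : Fin n} → i ≢ j → δ i j ≡ 0
δ-≢ {i = i} {j} i≢j with i ≟ j
... | yes i≡j = contradiction i≡j i≢j
... | no _ = refl

δ≡0⇒≢ : {i j : Fin n} → δ i j ≡ 0 → i ≢ j
δ≡0⇒≢ {i = i} δ≡0 refl with () ← trans (sym δ≡0) (δ-refl i)

δ>0⇒≡ : {i j : Fin n} → 0 < δ i j → i ≡ j
δ>0⇒≡ {i = i} {j} δ>0 with i ≟ j
... | yes i≡j = i≡j

δ-map : (f : Fin m → Fin n) → (∀ {i j} → f i ≡ f j → i ≡ j) → ∀ i j → δ (f i) (f j) ≡ δ i j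
δ-map f inj i j with i ≟ j
... | yes refl = δ-refl (f i)
... | no i≢j = δ-≢ (i≢j ∘ inj)

δ-sym : (i j : Fin n) → δ i j ≡ δ j i
δ-sym i j with i ≟ j
... | yes refl = sym (δ-refl i)
... | no i≢j = sym (δ-≢ (i≢j ∘ sym))

>0⊎≡0 : ∀ x → 0 < x ⊎ x ≡ 0
>0⊎≡0 zero = inj₂ refl
>0⊎≡0 (suc x) = inj₁ (s≤s z≤n)

sum-mono : {f g : Fin n → ℕ} → (∀ i → f i ≤ g i) → sum f ≤ sum g
sum-mono {zero} f≤g = z≤n
sum-mono {suc n} f≤g = +-mono-≤ (f≤g zero) (sum-mono (f≤g ∘ suc))

sum-mono-< : {f g : Fin n → ℕ} → (∀ i → f i ≤ g i) → ∀ i → f i < g i → sum f < sum g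
sum-mono-< f≤g zero f<g = +-mono-<-≤ f<g (sum-mono (f≤g ∘ suc))
sum-mono-< f≤g (suc i) f<g = +-mono-≤-< (f≤g zero) (sum-mono-< (f≤g ∘ suc) i f<g)

sum-pick : (f g : Fin n → ℕ) → sum f < sum g → Σ (Fin n) λ i → f i < g i
sum-pick {suc n} f g Σf<Σg with f zero <? g zero
... | yes f<g = zero , f<g
... | no f≮g with i , f<g ← sum-pick (f ∘ suc) (g ∘ suc)
                  (+-cancelˡ-< (g zero) _ _ (≤-<-trans (+-monoˡ-≤ _ (≮⇒≥ f≮g)) Σf<Σg)) = suc i , f<g

sum-zero : {f : Fin n → ℕ} → (∀ i → f i ≡ 0) → sum f ≡ 0
sum-zero {zero} f≡0 = refl
sum-zero {suc n} f≡0 = cong₂ _+_ (f≡0 zero) (sum-zero (f≡0 ∘ suc))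

term≤sum : (f : Fin n → ℕ) → ∀ i → f i ≤ sum f
term≤sum f zero = m≤m+n _ _
term≤sum f (suc i) = ≤-trans (term≤sum (f ∘ suc) i) (m≤n+m _ _)

sum≡0⇒≡0 : (f : Fin n → ℕ) → sum f ≡ 0 → ∀ i → f i ≡ 0
sum≡0⇒≡0 f Σ≡0 i = n≤0⇒n≡0 (≤-trans (term≤sum f i) (≤-reflexive Σ≡0))

sum-witness : (f : Fin n → ℕ) → 0 < sum f → Σ (Fin n) λ i → 0 < f i
sum-witness {n} f 0<Σ =
  sum-pick (λ _ → 0) f (≤-<-trans (≤-reflexive (sum-zero {n} (λ _ → refl))) 0<Σ)

sum-δ : (j : Fin n) (g : Fin n → ℕ) → sum (λ i → δ i j * g i) ≡ g j
sum-δ {suc n} j g = begin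
  sum (λ i → δ i j * g i)
    ≡⟨ sum-remove {i = j} (λ i → δ i j * g i) ⟩
  δ j j * g j + sum (λ i → δ (punchIn j i) j * g (punchIn j i))
    ≡⟨ cong₂ _+_ (cong (_* g j) (δ-refl j)) (sum-zero λ i → cong (_* g (punchIn j i)) (δ-≢ (punchInᵢ≢i j i))) ⟩
  1 * g j + 0
    ≡⟨ trans (+-identityʳ _) (*-identityˡ _) ⟩
  g j ∎
  where open ≡-Reasoning

sum-δ-1 : (j : Fin n) → sum (λ i → δ i j) ≡ 1
sum-δ-1 j = trans (sum-cong-≗ (λ i → sym (*-identityʳ (δ i j)))) (sum-δ j (λ _ → 1))

fibre-sum : (f : Fin k → Fin m) (g : Fin m → ℕ) →
            sum (λ j → g j * sum (λ v → δ (f v) j)) ≡ sum (λ v → g (f v))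
fibre-sum f g = begin
  sum (λ j → g j * sum (λ v → δ (f v) j))   ≡⟨ sum-cong-≗ (λ j → *-distribˡ-sum (g j) (λ v → δ (f v) j)) ⟩
  sum (λ j → sum (λ v → g j * δ (f v) j))   ≡⟨ ∑-comm (λ j v → g j * δ (f v) j) ⟩
  sum (λ v → sum (λ j → g j * δ (f v) j))   ≡⟨ sum-cong-≗ (λ v → sum-cong-≗ λ j → trans (*-comm (g j) _) (cong (_* g j) (δ-sym (f v) j))) ⟩
  sum (λ v → sum (λ j → δ j (f v) * g j))   ≡⟨ sum-cong-≗ (λ v → sum-δ (f v) g) ⟩
  sum (λ v → g (f v))                       ∎
  where open ≡-Reasoning

all-or-some : {P Q : Fin n → Set} → (∀ i → P i ⊎ Q i) → (∀ i → P i) ⊎ Σ (Fin n) Q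
all-or-some {zero} f = inj₁ λ ()
all-or-some {suc n} f with f zero | all-or-some (f ∘ suc)
... | inj₂ q | _ = inj₂ (zero , q)
... | inj₁ _ | inj₂ (i , q) = inj₂ (suc i , q)
... | inj₁ p | inj₁ ps = inj₁ λ { zero → p ; (suc i) → ps i }

-- Drives both greedy constructions below. The measure bounds the number of steps, so the fuel
-- `suc (μ x)` never runs out.
iterate : {S : Set} (μ : S → ℕ) {Done : S → Set} →
          (∀ x → Done x ⊎ Σ S λ y → μ y < μ x) → S → Σ S Done
iterate {S} μ {Done} step x = go (suc (μ x)) x ≤-refl
  where
  go : ∀ fuel x → μ x < fuel → Σ S Done
  go (suc fuel) x (s≤s μx≤) with step x
  ... | inj₁ done = x , done
  ... | inj₂ (y , μy<μx) = go fuel y (<-≤-trans μy<μx μx≤)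

-- Presburger definability

Env : ℕ → Set
Env n = Fin n → ℕ

lift : (Fin m → Fin n) → Fin (suc m) → Fin (suc n)
lift r zero = zero
lift r (suc i) = suc (r i)

renT : (Fin m → Fin n) → Term m → Term n
renT r (var i) = var (r i)
renT r `0 = `0
renT r `1 = `1
renT r (s ⊕ t) = renT r s ⊕ renT r t

ren : (Fin m → Fin n) → Formula m → Formula n
ren r (s ≤′ t) = renT r s ≤′ renT r t
ren r (s ≡′ t) = renT r s ≡′ renT r t
ren r ⊤′ = ⊤′
ren r ⊥′ = ⊥′
ren r (¬′ φ) = ¬′ ren r φ
ren r (φ ∧′ ψ) = ren r φ ∧′ ren r ψ
ren r (φ ∨′ ψ) = ren r φ ∨′ ren r ψ
ren r (φ ⇒′ ψ) = ren r φ ⇒′ ren r ψ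
ren r (∃′ φ) = ∃′ (ren (lift r) φ)
ren r (∀′ φ) = ∀′ (ren (lift r) φ)

lift-env : {r : Fin m → Fin n} {ρ : Env m} {ρ′ : Env n} → (∀ i → ρ′ (r i) ≡ ρ i) →
           ∀ a i → (a ∷ₑ ρ′) (lift r i) ≡ (a ∷ₑ ρ) i
lift-env eq a zero = refl
lift-env eq a (suc i) = eq i

evalT-ren : {r : Fin m → Fin n} {ρ : Env m} {ρ′ : Env n} → (∀ i → ρ′ (r i) ≡ ρ i) →
            ∀ t → evalT (renT r t) ρ′ ≡ evalT t ρ
evalT-ren eq (var i) = eq i
evalT-ren eq `0 = refl
evalT-ren eq `1 = refl
evalT-ren eq (s ⊕ t) = cong₂ _+_ (evalT-ren eq s) (evalT-ren eq t)

mutual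
  -- Negation and implication exchange the two directions, so both are proved in one mutual
  -- induction.
  ren⇒ : {r : Fin m → Fin n} {ρ : Env m} {ρ′ : Env n} → (∀ i → ρ′ (r i) ≡ ρ i) →
         ∀ φ → ⟦ ren r φ ⟧ ρ′ → ⟦ φ ⟧ ρ
  ren⇒ eq (s ≤′ t) h = subst (_≤ _) (evalT-ren eq s) (subst (_ ≤_) (evalT-ren eq t) h)
  ren⇒ eq (s ≡′ t) h = trans (sym (evalT-ren eq s)) (trans h (evalT-ren eq t))
  ren⇒ eq ⊤′ h = h
  ren⇒ eq (¬′ φ) h = h ∘ ren⇐ eq φ
  ren⇒ eq (φ ∧′ ψ) (h , h′) = ren⇒ eq φ h , ren⇒ eq ψ h′
  ren⇒ eq (φ ∨′ ψ) (inj₁ h) = inj₁ (ren⇒ eq φ h)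
  ren⇒ eq (φ ∨′ ψ) (inj₂ h) = inj₂ (ren⇒ eq ψ h)
  ren⇒ eq (φ ⇒′ ψ) h = ren⇒ eq ψ ∘ h ∘ ren⇐ eq φ
  ren⇒ eq (∃′ φ) (a , h) = a , ren⇒ (lift-env eq a) φ h
  ren⇒ eq (∀′ φ) h a = ren⇒ (lift-env eq a) φ (h a)

  ren⇐ : {r : Fin m → Fin n} {ρ : Env m} {ρ′ : Env n} → (∀ i → ρ′ (r i) ≡ ρ i) →
         ∀ φ → ⟦ φ ⟧ ρ → ⟦ ren r φ ⟧ ρ′
  ren⇐ eq (s ≤′ t) h = subst (_≤ _) (sym (evalT-ren eq s)) (subst (_ ≤_) (sym (evalT-ren eq t)) h)
  ren⇐ eq (s ≡′ t) h = trans (evalT-ren eq s) (trans h (sym (evalT-ren eq t)))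
  ren⇐ eq ⊤′ h = h
  ren⇐ eq (¬′ φ) h = h ∘ ren⇒ eq φ
  ren⇐ eq (φ ∧′ ψ) (h , h′) = ren⇐ eq φ h , ren⇐ eq ψ h′
  ren⇐ eq (φ ∨′ ψ) (inj₁ h) = inj₁ (ren⇐ eq φ h)
  ren⇐ eq (φ ∨′ ψ) (inj₂ h) = inj₂ (ren⇐ eq ψ h)
  ren⇐ eq (φ ⇒′ ψ) h = ren⇐ eq ψ ∘ h ∘ ren⇒ eq φ
  ren⇐ eq (∃′ φ) (a , h) = a , ren⇐ (lift-env eq a) φ h
  ren⇐ eq (∀′ φ) h a = ren⇐ (lift-env eq a) φ (h a)

-- Pointwise equality is exactly the premise of renaming along `id`, so `ren id φ` serves as an
-- intermediate formula.
⟦⟧-cong : {ρ ρ′ : Env n} → ρ ≗ ρ′ → ∀ φ → ⟦ φ ⟧ ρ → ⟦ φ ⟧ ρ′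
⟦⟧-cong eq φ h = ren⇒ {r = id} (λ _ → refl) φ (ren⇐ {r = id} (sym ∘ eq) φ h)

-- Some formula lies between P and Q; Sandwich P P says that P is definable.
record Sandwich {n} (P Q : Env n → Set) : Set where
  constructor sandwich
  field
    formula  : Formula n
    complete : ∀ ρ → P ρ → ⟦ formula ⟧ ρ
    sound    : ∀ ρ → ⟦ formula ⟧ ρ → Q ρ

private
  variable
    P P′ Q Q′ : Env n → Set

weaken : (∀ ρ → P′ ρ → P ρ) → (∀ ρ → Q ρ → Q′ ρ) → Sandwich P Q → Sandwich P′ Q′
weaken f g (sandwich φ c s) = sandwich φ (λ ρ → c ρ ∘ f ρ) (λ ρ → g ρ ∘ s ρ)

rename-≬ : (r : Fin m → Fin n) → Sandwich P Q → Sandwich (λ ρ → P (ρ ∘ r)) (λ ρ → Q (ρ ∘ r))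
rename-≬ r (sandwich φ c s) =
  sandwich (ren r φ) (λ ρ → ren⇐ (λ _ → refl) φ ∘ c _) (λ ρ → s _ ∘ ren⇒ (λ _ → refl) φ)

∧-≬ : Sandwich P Q → Sandwich P′ Q′ → Sandwich (λ ρ → P ρ × P′ ρ) (λ ρ → Q ρ × Q′ ρ)
∧-≬ (sandwich φ c s) (sandwich φ′ c′ s′) =
  sandwich (φ ∧′ φ′) (λ { ρ (h , h′) → c ρ h , c′ ρ h′ }) (λ { ρ (h , h′) → s ρ h , s′ ρ h′ })

∨-≬ : Sandwich P Q → Sandwich P′ Q′ → Sandwich (λ ρ → P ρ ⊎ P′ ρ) (λ ρ → Q ρ ⊎ Q′ ρ)
∨-≬ (sandwich φ c s) (sandwich φ′ c′ s′) =
  sandwich (φ ∨′ φ′)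
    (λ { ρ (inj₁ h) → inj₁ (c ρ h) ; ρ (inj₂ h) → inj₂ (c′ ρ h) })
    (λ { ρ (inj₁ h) → inj₁ (s ρ h) ; ρ (inj₂ h) → inj₂ (s′ ρ h) })

const-≬ : {X : Set} → Dec X → Sandwich {n} (λ _ → X) (λ _ → X)
const-≬ (yes x) = sandwich ⊤′ (λ _ _ ()) (λ _ _ → x)
const-≬ (no ¬x) = sandwich ⊥′ (λ _ → ¬x) (λ _ → ⊥-elim)

⋀-≬ : {P Q : Fin k → Env n → Set} → (∀ i → Sandwich (P i) (Q i)) →
      Sandwich (λ ρ → ∀ i → P i ρ) (λ ρ → ∀ i → Q i ρ)
⋀-≬ {zero} S = sandwich ⊤′ (λ _ _ ()) (λ _ _ ())
⋀-≬ {suc k} S = weaken (λ ρ h → h zero , h ∘ suc) (λ { ρ (h , _) zero → h ; ρ (_ , h) (suc i) → h i })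
                  (∧-≬ (S zero) (⋀-≬ (S ∘ suc)))

⋁-≬ : {P Q : Fin k → Env n → Set} → (∀ i → Sandwich (P i) (Q i)) →
      Sandwich (λ ρ → Σ (Fin k) λ i → P i ρ) (λ ρ → Σ (Fin k) λ i → Q i ρ)
⋁-≬ {zero} S = sandwich ⊥′ (λ { _ (() , _) }) (λ _ → ⊥-elim)
⋁-≬ {suc k} S =
  weaken (λ { ρ (zero , h) → inj₁ h ; ρ (suc i , h) → inj₂ (i , h) })
         (λ { ρ (inj₁ h) → zero , h ; ρ (inj₂ (i , h)) → suc i , h })
         (∨-≬ (S zero) (⋁-≬ (S ∘ suc)))

-- The first `k` variables are bound, `zero` by the innermost quantifier; the free variable `j`
-- appears in the body as `k ↑ʳ j`.
∃^ : ∀ k → Formula (k + n) → Formula n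
∃^ zero φ = φ
∃^ (suc k) φ = ∃^ k (∃′ φ)

∃^⇐ : ∀ k (φ : Formula (k + n)) (ρ : Env (k + n)) {ρ′ : Env n} →
      (∀ j → ρ (k ↑ʳ j) ≡ ρ′ j) → ⟦ φ ⟧ ρ → ⟦ ∃^ k φ ⟧ ρ′
∃^⇐ zero φ ρ eq h = ⟦⟧-cong eq φ h
∃^⇐ (suc k) φ ρ eq h =
  ∃^⇐ k (∃′ φ) (ρ ∘ suc) eq (ρ zero , ⟦⟧-cong (λ { zero → refl ; (suc i) → refl }) φ h)

∃^⇒ : ∀ k (φ : Formula (k + n)) (ρ′ : Env n) → ⟦ ∃^ k φ ⟧ ρ′ →
      Σ (Env (k + n)) λ ρ → (∀ j → ρ (k ↑ʳ j) ≡ ρ′ j) × ⟦ φ ⟧ ρ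
∃^⇒ zero φ ρ′ h = ρ′ , (λ _ → refl) , h
∃^⇒ (suc k) φ ρ′ h with ρ , eq , a , h′ ← ∃^⇒ k (∃′ φ) ρ′ h = a ∷ₑ ρ , eq , h′

∃-≬ : ∀ k {P Q : Env (k + n) → Set} → Sandwich P Q →
      Sandwich (λ ρ′ → Σ (Env (k + n)) λ ρ → (∀ j → ρ (k ↑ʳ j) ≡ ρ′ j) × P ρ)
               (λ ρ′ → Σ (Env (k + n)) λ ρ → (∀ j → ρ (k ↑ʳ j) ≡ ρ′ j) × Q ρ)
∃-≬ k (sandwich φ c s) = sandwich (∃^ k φ)
  (λ { ρ′ (ρ , eq , h) → ∃^⇐ k φ ρ eq (c ρ h) })
  (λ ρ′ h → let ρ , eq , h′ = ∃^⇒ k φ ρ′ h in ρ , eq , s ρ h′)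

-- Linear terms and linear conditions

num : ℕ → Term n
num zero = `0
num (suc d) = `1 ⊕ num d

evalT-num : ∀ d (ρ : Env n) → evalT (num d) ρ ≡ d
evalT-num zero ρ = refl
evalT-num (suc d) ρ = cong suc (evalT-num d ρ)

scale : ℕ → Term n → Term n
scale zero t = `0
scale (suc d) t = t ⊕ scale d t

evalT-scale : ∀ d (t : Term n) ρ → evalT (scale d t) ρ ≡ d * evalT t ρ
evalT-scale zero t ρ = refl
evalT-scale (suc d) t ρ = cong (evalT t ρ +_) (evalT-scale d t ρ)

sumT : (Fin k → Term n) → Term n
sumT {zero} t = `0
sumT {suc k} t = t zero ⊕ sumT (t ∘ suc)

evalT-sum : (t : Fin k → Term n) (ρ : Env n) → evalT (sumT t) ρ ≡ sum (λ i → evalT (t i) ρ)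
evalT-sum {zero} t ρ = refl
evalT-sum {suc k} t ρ = cong (evalT (t zero) ρ +_) (evalT-sum (t ∘ suc) ρ)

record Linear {n} (f : Env n → ℕ) : Set where
  constructor linear
  field
    term   : Term n
    eval-≡ : ∀ ρ → evalT term ρ ≡ f ρ

private
  variable
    e e′ : Env n → ℕ

var-lin : (i : Fin n) → Linear (λ ρ → ρ i)
var-lin i = linear (var i) (λ _ → refl)

num-lin : ∀ d → Linear {n} (λ _ → d)
num-lin d = linear (num d) (evalT-num d)

+-lin : Linear e → Linear e′ → Linear (λ ρ → e ρ + e′ ρ)
+-lin (linear s p) (linear t q) = linear (s ⊕ t) (λ ρ → cong₂ _+_ (p ρ) (q ρ))

Σ-lin : (c : Fin k → ℕ) (r : Fin k → Fin n) → Linear (λ ρ → sum (λ i → c i * ρ (r i)))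
Σ-lin c r = linear (sumT λ i → scale (c i) (var (r i))) λ ρ →
  trans (evalT-sum (λ i → scale (c i) (var (r i))) ρ) (sum-cong-≗ λ i → evalT-scale (c i) (var (r i)) ρ)

≤-≬ : Linear e → Linear e′ → Sandwich (λ ρ → e ρ ≤ e′ ρ) (λ ρ → e ρ ≤ e′ ρ)
≤-≬ (linear s p) (linear t q) = sandwich (s ≤′ t)
  (λ ρ h → subst (_≤ _) (sym (p ρ)) (subst (_ ≤_) (sym (q ρ)) h))
  (λ ρ h → subst (_≤ _) (p ρ) (subst (_ ≤_) (q ρ) h))

≡-≬ : Linear e → Linear e′ → Sandwich (λ ρ → e ρ ≡ e′ ρ) (λ ρ → e ρ ≡ e′ ρ)
≡-≬ (linear s p) (linear t q) = sandwich (s ≡′ t)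
  (λ ρ h → trans (p ρ) (trans h (sym (q ρ))))
  (λ ρ h → trans (sym (p ρ)) (trans h (q ρ)))

≐-≬ : Linear e → ∀ b → Sandwich (λ ρ → e ρ ≐ b) (λ ρ → e ρ ≐ b)
≐-≬ e-lin (exactly d) = ≡-≬ e-lin (num-lin d)
≐-≬ e-lin (atLeast d) = ≤-≬ (num-lin d) e-lin

-- Degree requirements

pos : ℕ → ℕ
pos zero = 0
pos (suc _) = 1

<pos⁻ : ∀ {x y} → x < pos y → x ≡ 0 × 0 < y
<pos⁻ {y = suc _} (s≤s z≤n) = refl , s≤s z≤n

<⇒1≤pos : ∀ {x y} → x < y → 1 ≤ pos y
<⇒1≤pos (s≤s _) = s≤s z≤n

<⇒+1≤ : ∀ {x y} → x < y → x + 1 ≤ y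
<⇒+1≤ {x} {y} x<y = subst (_≤ y) (+-comm 1 x) x<y

≤⇒+0≤ : ∀ {x y} → x ≤ y → x + 0 ≤ y
≤⇒+0≤ {x} {y} x≤y = subst (_≤ y) (sym (+-identityʳ x)) x≤y

zero-factor : ∀ p {q} → p * q ≡ 0 → 0 < q → p ≡ 0
zero-factor zero _ _ = refl
zero-factor (suc p) {suc q} () _

∸-strictʳ : ∀ {x y z} → z < y → z < x → x ∸ y < x ∸ z
∸-strictʳ {suc x} {suc y} {zero} _ _ = s≤s (m∸n≤m x y)
∸-strictʳ {suc x} {suc y} {suc z} (s≤s z<y) (s≤s z<x) = ∸-strictʳ z<y z<x

lb : 𝔹 → ℕ
lb (exactly d) = d
lb (atLeast d) = d

-- Valued in `ℕ`, so that numbers of vertices with unbounded degree are sums, linear in the part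
-- sizes.
isAtLeast : 𝔹 → ℕ
isAtLeast (exactly _) = 0
isAtLeast (atLeast _) = 1

isAtLeast≤1 : ∀ b → isAtLeast b ≤ 1
isAtLeast≤1 (exactly _) = z≤n
isAtLeast≤1 (atLeast _) = s≤s z≤n

-- What is left to meet once `h` edges are accounted for. Truncation is correct for `atLeast`, where
-- a surplus is allowed; for `exactly` it has to be paired with `Feasible`.
lower : ℕ → 𝔹 → 𝔹
lower h (exactly d) = exactly (d ∸ h)
lower h (atLeast d) = atLeast (d ∸ h)

Feasible : ℕ → 𝔹 → Set
Feasible h (exactly d) = h ≤ d
Feasible h (atLeast d) = ⊤

feasible? : ∀ h b → Dec (Feasible h b)
feasible? h (exactly d) = h ≤? d
feasible? h (atLeast d) = yes tt

≐-lower : ∀ {h x} b → (h + x) ≐ b → Feasible h b × x ≐ lower h b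
≐-lower {h} {x} (exactly d) refl = m≤m+n h x , sym (m+n∸m≡n h x)
≐-lower {h} {x} (atLeast d) d≤h+x = tt , m≤n+o⇒m∸n≤o d h d≤h+x

≐-raise : ∀ {h x} b → Feasible h b → x ≐ lower h b → (h + x) ≐ b
≐-raise (exactly d) h≤d refl = m+[n∸m]≡n h≤d
≐-raise {h} (atLeast d) _ d∸h≤x = ≤-trans (m≤n+m∸n d h) (+-monoʳ-≤ h d∸h≤x)

≐⇒lb≤ : ∀ {x} b → x ≐ b → lb b ≤ x
≐⇒lb≤ (exactly d) refl = ≤-refl
≐⇒lb≤ (atLeast d) d≤x = d≤x

≐⇒≤lb : ∀ {x} b → isAtLeast b ≡ 0 → x ≐ b → x ≤ lb b
≐⇒≤lb (exactly d) _ refl = ≤-refl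

lb-lower : ∀ h b → lb (lower h b) ≤ lb b
lb-lower h (exactly d) = m∸n≤m d h
lb-lower h (atLeast d) = m∸n≤m d h

isAtLeast-lower : ∀ h b → isAtLeast (lower h b) ≡ isAtLeast b
isAtLeast-lower h (exactly d) = refl
isAtLeast-lower h (atLeast d) = refl

pos-mono : ∀ {x y} → x ≤ y → pos x ≤ pos y
pos-mono z≤n = z≤n
pos-mono (s≤s _) = s≤s z≤n

Counts : (Fin k → Fin m) → Env m → Set
Counts part N = ∀ j → sum (λ v → δ (part v) j) ≡ N j

-- The bridge between formulas and graphs: linear forms in the part sizes become sums over vertices.
weighted-sum : (part : Fin k → Fin m) {N : Env m} → Counts part N → (g : Fin m → ℕ) →
               sum (λ j → g j * N j) ≡ sum (λ v → g (part v))
weighted-sum part counts g =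
  trans (sum-cong-≗ (λ j → cong (g j *_) (sym (counts j)))) (fibre-sum part g)

inhabited : (part : Fin k → Fin m) {N : Env m} → Counts part N → ∀ v → N (part v) ≢ 0
inhabited part counts v N≡0 =
  contradiction (trans (sym (δ-refl (part v)))
                       (sum≡0⇒≡0 (λ u → δ (part u) (part v)) (trans (counts (part v)) N≡0) v)) (λ ())

blow-up : (N : Env m) → Σ ℕ λ k → Σ (Fin k → Fin m) λ part → Counts part N
blow-up {zero} N = 0 , (λ ()) , (λ ())
blow-up {suc m} N with k , part , counts ← blow-up (N ∘ suc) =
  let k′ , part′ , counts₀ , counts₊ = grow (N zero)
  in k′ , part′ , λ { zero → counts₀ ; (suc j) → counts₊ j }
  where
  grow : ∀ c → Σ ℕ λ k′ → Σ (Fin k′ → Fin (suc m)) λ part′ →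
         (sum (λ v → δ (part′ v) zero) ≡ c) × (∀ j → sum (λ v → δ (part′ v) (suc j)) ≡ N (suc j))
  grow zero = k , suc ∘ part , sum-zero {k} (λ _ → refl) ,
    λ j → trans (sum-cong-≗ (λ v → δ-map suc suc-injective (part v) j)) (counts j)
  grow (suc c) with k′ , part′ , counts₀ , counts₊ ← grow c =
    suc k′ , (λ { zero → zero ; (suc v) → part′ v }) , cong suc counts₀ , counts₊

-- Systems of representatives and levels

sum-ones : ∀ n → sum {n} (λ _ → 1) ≡ n
sum-ones zero = refl
sum-ones (suc n) = cong suc (sum-ones n)

δ≤1 : (i j : Fin n) → δ i j ≤ 1
δ≤1 i j with i ≟ j
... | yes _ = s≤s z≤n
... | no _ = z≤n

except : Fin n → (Fin n → ℕ) → Fin n → ℕ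
except q L i = if ⌊ i ≟ q ⌋ then 0 else L i

sum-except : (q : Fin n) (L : Fin n → ℕ) → 0 < L q → sum (except q L) < sum L
sum-except q L L>0 = sum-mono-< below q (subst (_< L q) (sym at-q) L>0)
  where
  below : ∀ i → except q L i ≤ L i
  below i with i ≟ q
  ... | yes _ = z≤n
  ... | no _ = ≤-refl
  at-q : except q L q ≡ 0
  at-q with q ≟ q
  ... | yes _ = refl
  ... | no q≢q = contradiction refl q≢q

-- Three is the least length of a cycle on which successor and predecessor differ. An edge to the
-- next level is therefore never such an edge for its other end.
next : Fin 3 → Fin 3
next zero = suc zero
next (suc zero) = suc (suc zero)
next (suc (suc zero)) = zero

next≢ : ∀ b → next b ≢ b
next≢ zero ()
next≢ (suc zero) ()
next≢ (suc (suc zero)) ()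

next²≢ : ∀ b → next (next b) ≢ b
next²≢ zero ()
next²≢ (suc zero) ()
next²≢ (suc (suc zero)) ()

-- Greedy choice, with `c` as the weight of the points already taken. Each weight `p i` exceeds `c`
-- in total, so some point has `c v < p i v ≤ 1`, hence is free and lies in the set `p i`; taking it
-- raises `sum c` by one while one set fewer remains.
distinct-representatives :
  (p : Fin n → Fin k → ℕ) (c : Fin k → ℕ) → (∀ i v → p i v ≤ 1) → (∀ i → n + sum c ≤ sum (p i)) →
  Σ (Fin n → Fin k) λ g → (∀ i → p i (g i) ≡ 1) × (∀ i → c (g i) ≡ 0) × (∀ {i j} → g i ≡ g j → i ≡ j)
distinct-representatives {zero} p c p≤1 large = (λ ()) , (λ ()) , (λ ()) , λ { {()} }
distinct-representatives {suc n} {k} p c p≤1 large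
  with v , c<p ← sum-pick c (p zero) (≤-trans (s≤s (m≤n+m (sum c) n)) (large zero))
  with g , p∘g , c∘g , inj ← distinct-representatives (p ∘ suc) (λ w → δ w v + c w) (p≤1 ∘ suc)
         (λ i → ≤-trans (≤-reflexive (trans (cong (n +_) (trans (∑-distrib-+ (λ w → δ w v) c) (cong (_+ sum c) (sum-δ-1 v)))) (+-suc n (sum c)))) (large (suc i)))
  = g′ , p∘g′ , c∘g′ , inj′
  where
  g′ : Fin (suc n) → Fin k
  g′ zero = v
  g′ (suc i) = g i
  p∘g′ : ∀ i → p i (g′ i) ≡ 1
  p∘g′ zero = ≤-antisym (p≤1 zero v) (≤-trans (s≤s z≤n) c<p)
  p∘g′ (suc i) = p∘g i
  c∘g′ : ∀ i → c (g′ i) ≡ 0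
  c∘g′ zero = n<1⇒n≡0 (<-≤-trans c<p (p≤1 zero v))
  c∘g′ (suc i) = m+n≡0⇒n≡0 (δ (g i) v) (c∘g i)
  fresh : ∀ i → g i ≢ v
  fresh i = δ≡0⇒≢ (m+n≡0⇒m≡0 _ (c∘g i))
  inj′ : ∀ {i j} → g′ i ≡ g′ j → i ≡ j
  inj′ {zero} {zero} eq = refl
  inj′ {zero} {suc j} eq = contradiction (sym eq) (fresh j)
  inj′ {suc i} {zero} eq = contradiction eq (fresh i)
  inj′ {suc i} {suc j} eq = cong suc (inj eq)

-- The fibres of an injective map have at most one element.
sum-∘-injective : (g : Fin n → Fin k) → (∀ {i j} → g i ≡ g j → i ≡ j) → (c : Fin k → ℕ) →
                  sum (c ∘ g) ≤ sum c
sum-∘-injective g inj c = begin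
  sum (λ i → c (g i))                     ≡⟨ fibre-sum g c ⟨
  sum (λ v → c v * sum (λ i → δ (g i) v)) ≤⟨ sum-mono (λ v → *-monoʳ-≤ (c v) (fibre≤1 v)) ⟩
  sum (λ v → c v * 1)                     ≡⟨ sum-cong-≗ (λ v → *-identityʳ (c v)) ⟩
  sum c                                   ∎
  where
  open ≤-Reasoning
  fibre≤1 : ∀ v → sum (λ i → δ (g i) v) ≤ 1
  fibre≤1 v with >0⊎≡0 (sum (λ i → δ (g i) v))
  ... | inj₂ ≡0 = subst (_≤ 1) (sym ≡0) z≤n
  ... | inj₁ >0 with j , hit-j ← sum-witness (λ i → δ (g i) v) >0 =
    ≤-reflexive (trans (sum-cong-≗ λ i → trans (cong (δ (g i)) (sym (δ>0⇒≡ hit-j))) (δ-map g inj i j)) (sum-δ-1 j))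

-- Representatives for all triples of a set, a level and one of `c` copies are chosen distinct at
-- once. A representative then gets the level in its triple, without conflict.
levels : (c : ℕ) (p : Fin n → Fin k → ℕ) → (∀ s v → p s v ≤ 1) →
         (∀ s → sum (p s) ≡ 0 ⊎ n * (3 * c) ≤ sum (p s)) →
         Σ (Fin k → Fin 3) λ level → ∀ s b → sum (p s) ≡ 0 ⊎
           (Σ (Fin c → Fin k) λ g → (∀ {i j} → g i ≡ g j → i ≡ j) ×
             (∀ i → p s (g i) ≡ 1) × (∀ i → level (g i) ≡ b))
levels {n} {k} c p p≤1 large with all-or-some large
... | inj₁ none = (λ _ → zero) , λ s b → inj₁ (none s)
... | inj₂ (s₀ , large₀) = level , family
  where
  -- An empty p s borrows the representatives of s₀.
  live : ∀ s → sum (p s) ≡ 0 ⊎ n * (3 * c) ≤ sum (p s) → Fin n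
  live s (inj₁ _) = s₀
  live s (inj₂ _) = s
  live-large : ∀ s d → n * (3 * c) ≤ sum (p (live s d))
  live-large s (inj₁ _) = large₀
  live-large s (inj₂ big) = big
  slot : Fin (n * (3 * c)) → Fin n
  slot = proj₁ ∘ remQuot (3 * c)
  lvl : Fin (n * (3 * c)) → Fin 3
  lvl = proj₁ ∘ remQuot c ∘ proj₂ ∘ remQuot {n} (3 * c)
  sdr = distinct-representatives (λ i → p (live (slot i) (large (slot i)))) (λ _ → 0) (λ i → p≤1 _)
          (λ i → ≤-trans (≤-reflexive (trans (cong (n * (3 * c) +_) (sum-zero {k} (λ _ → refl))) (+-identityʳ _))) (live-large (slot i) (large (slot i))))
  rep = proj₁ sdr
  rep-p = proj₁ (proj₂ sdr)
  rep-inj : ∀ {i j} → rep i ≡ rep j → i ≡ j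
  rep-inj = proj₂ (proj₂ (proj₂ sdr))
  level : Fin k → Fin 3
  level v with any? (λ i → rep i ≟ v)
  ... | yes (i , _) = lvl i
  -- Points that represent nothing may have any level.
  ... | no _ = zero
  level-rep : ∀ i → level (rep i) ≡ lvl i
  level-rep i with any? (λ j → rep j ≟ rep i)
  ... | yes (j , eq) = cong lvl (rep-inj eq)
  ... | no ¬rep = contradiction (i , refl) ¬rep
  index : Fin n → Fin 3 → Fin c → Fin (n * (3 * c))
  index s b i = combine s (combine b i)
  slot-index : ∀ s b i → slot (index s b i) ≡ s
  slot-index s b i = cong proj₁ (remQuot-combine s (combine b i))
  lvl-index : ∀ s b i → lvl (index s b i) ≡ b
  lvl-index s b i = trans (cong (proj₁ ∘ remQuot {3} c ∘ proj₂) (remQuot-combine s (combine b i))) (cong proj₁ (remQuot-combine b i))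
  family : ∀ s b → sum (p s) ≡ 0 ⊎
           (Σ (Fin c → Fin k) λ g → (∀ {i j} → g i ≡ g j → i ≡ j) ×
             (∀ i → p s (g i) ≡ 1) × (∀ i → level (g i) ≡ b))
  family s b with large s in eq
  ... | inj₁ ≡0 = inj₁ ≡0
  ... | inj₂ _ = inj₂ (rep ∘ index s b ,
    (λ {i} {j} e → combine-injectiveʳ b i b j (combine-injectiveʳ s (combine b i) s (combine b j) (rep-inj e))) ,
    (λ i → trans (cong (λ z → p z (rep (index s b i))) (sym (live-index i))) (rep-p (index s b i))) ,
    (λ i → trans (level-rep (index s b i)) (lvl-index s b i)))
    where
    live-index : ∀ i → live (slot (index s b i)) (large (slot (index s b i))) ≡ s
    live-index i rewrite slot-index s b i | eq = refl

-- Labelled graphs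

module Labelled {σ : ℕ} (flip : Fin σ → Fin σ) (flip-flip : ∀ s → flip (flip s) ≡ s)
                (flip≢ : ∀ s → flip s ≢ s) where

  -- A single label per pair of vertices builds in the disjointness of the colours and, with the
  -- flip on the opposite pair, their asymmetry.
  Label : Set
  Label = Maybe (Fin σ)

  -- label u v ≡ just s: there is an edge with s-end u and (flip s)-end v.
  record Graph (k : ℕ) : Set where
    field
      label  : Fin k → Fin k → Label
      irrefl : ∀ v → label v v ≡ nothing
      symm   : ∀ u v → label v u ≡ map flip (label u v)

  open Graph

  hit : Fin σ → Label → ℕ
  hit s nothing = 0
  hit s (just t) = δ s t

  deg : Graph k → Fin σ → Fin k → ℕ
  deg G s v = sum (λ u → hit s (label G v u))

  adj : Label → ℕ
  adj nothing = 0
  adj (just _) = 1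

  hit>0 : ∀ {s} x → 0 < hit s x → x ≡ just s
  hit>0 (just t) h = cong just (sym (δ>0⇒≡ h))

  adj≡0 : ∀ x → adj x ≡ 0 → x ≡ nothing
  adj≡0 nothing _ = refl

  flip-injective : ∀ {s t} → flip s ≡ flip t → s ≡ t
  flip-injective {s} {t} eq = trans (sym (flip-flip s)) (trans (cong flip eq) (flip-flip t))

  map-flip-flip : ∀ x → map flip (map flip x) ≡ x
  map-flip-flip nothing = refl
  map-flip-flip (just s) = cong just (flip-flip s)

  hit-flip : ∀ s x → hit (flip s) (map flip x) ≡ hit s x
  hit-flip s nothing = refl
  hit-flip s (just t) = δ-map flip flip-injective s t

  sum-hit : ∀ x → sum (λ t → hit t x) ≡ adj x
  sum-hit nothing = sum-zero {σ} (λ _ → refl)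
  sum-hit (just s) = sum-δ-1 s

  sum-deg : (G : Graph k) → ∀ u → sum (λ t → deg G t u) ≡ sum (λ w → adj (label G u w))
  sum-deg G u = trans (∑-comm (λ t w → hit t (label G u w))) (sum-cong-≗ λ w → sum-hit (label G u w))

  -- Each edge with an `s`-end has a `flip s`-end at its other vertex; count these edges from either
  -- side.
  handshake : (G : Graph k) → ∀ s → sum (deg G s) ≡ sum (deg G (flip s))
  handshake G s = begin
    sum (λ u → sum (λ v → hit s (label G u v)))         ≡⟨ sum-cong-≗ (λ u → sum-cong-≗ λ v → lemma u v) ⟩
    sum (λ u → sum (λ v → hit (flip s) (label G v u)))  ≡⟨ ∑-comm (λ u v → hit (flip s) (label G v u)) ⟩
    sum (λ v → sum (λ u → hit (flip s) (label G v u)))  ∎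
    where
    open ≡-Reasoning
    lemma : ∀ u v → hit s (label G u v) ≡ hit (flip s) (label G v u)
    lemma u v = trans (sym (hit-flip s (label G u v))) (cong (hit (flip s)) (sym (symm G u v)))

  empty : Graph k
  empty = record { label = λ _ _ → nothing ; irrefl = λ _ → refl ; symm = λ _ _ → refl }

  deg-empty : ∀ s v → deg (empty {k}) s v ≡ 0
  deg-empty {k} s v = sum-zero {k} (λ _ → refl)

  -- Adding, removing and switching edges

  relabel : (G : Graph k) (u w : Fin k) → u ≢ w → Label → Graph k
  relabel {k} G u w u≢w x = record { label = ℓ ; irrefl = ℓ-irrefl ; symm = ℓ-symm }
    where
    ℓ : Fin k → Fin k → Label
    ℓ a b with a ≟ u | b ≟ w | a ≟ w | b ≟ u
    ... | yes _ | yes _ | _ | _ = x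
    ... | yes _ | no _ | yes _ | yes _ = map flip x
    ... | yes _ | no _ | yes _ | no _ = label G a b
    ... | yes _ | no _ | no _ | _ = label G a b
    ... | no _ | _ | yes _ | yes _ = map flip x
    ... | no _ | _ | yes _ | no _ = label G a b
    ... | no _ | _ | no _ | _ = label G a b
    ℓ-irrefl : ∀ v → ℓ v v ≡ nothing
    ℓ-irrefl v with v ≟ u | v ≟ w
    ... | yes refl | yes refl = contradiction refl u≢w
    ... | yes _ | no _ = irrefl G v
    ... | no _ | yes _ = irrefl G v
    ... | no _ | no _ = irrefl G v
    ℓ-symm : ∀ a b → ℓ b a ≡ map flip (ℓ a b)
    ℓ-symm a b with a ≟ u | b ≟ w | a ≟ w | b ≟ u
    ... | yes refl | _ | yes refl | _ = contradiction refl u≢w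
    ... | _ | yes refl | _ | yes refl = contradiction refl u≢w
    ... | yes _ | yes _ | no _ | no _ = refl
    ... | yes _ | no _ | no _ | yes _ = symm G a b
    ... | yes _ | no _ | no _ | no _ = symm G a b
    ... | no _ | yes _ | yes _ | no _ = symm G a b
    ... | no _ | yes _ | no _ | no _ = symm G a b
    ... | no _ | no _ | yes _ | yes _ = sym (map-flip-flip x)
    ... | no _ | no _ | yes _ | no _ = symm G a b
    ... | no _ | no _ | no _ | yes _ = symm G a b
    ... | no _ | no _ | no _ | no _ = symm G a b

  relabel-at : (G : Graph k) (u w : Fin k) (u≢w : u ≢ w) (x : Label) → label (relabel G u w u≢w x) u w ≡ x
  relabel-at G u w u≢w x with u ≟ u | w ≟ w | u ≟ w | w ≟ u
  ... | yes _ | yes _ | _ | _ = refl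
  ... | no u≢u | _ | _ | _ = contradiction refl u≢u
  ... | yes _ | no w≢w | _ | _ = contradiction refl w≢w

  relabel-off : (G : Graph k) (u w : Fin k) (u≢w : u ≢ w) (x : Label) → ∀ a b →
                ¬ (a ≡ u × b ≡ w) → ¬ (a ≡ w × b ≡ u) → label (relabel G u w u≢w x) a b ≡ label G a b
  relabel-off G u w u≢w x a b ¬1 ¬2 with a ≟ u | b ≟ w | a ≟ w | b ≟ u
  ... | yes p | yes q | _ | _ = contradiction (p , q) ¬1
  ... | yes _ | no _ | yes p | yes q = contradiction (p , q) ¬2
  ... | yes _ | no _ | yes _ | no _ = refl
  ... | yes _ | no _ | no _ | _ = refl
  ... | no _ | _ | yes p | yes q = contradiction (p , q) ¬2
  ... | no _ | _ | yes _ | no _ = refl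
  ... | no _ | _ | no _ | _ = refl

  -- A relation rather than an operation, so that addition and removal share one description:
  -- removal is the same relation read backwards.
  record Adds (G G′ : Graph k) (u w : Fin k) (s : Fin σ) : Set where
    field
      before : label G u w ≡ nothing
      after  : label G′ u w ≡ just s
      same   : ∀ a b → ¬ (a ≡ u × b ≡ w) → ¬ (a ≡ w × b ≡ u) → label G′ a b ≡ label G a b

  open Adds

  add : (G : Graph k) (u w : Fin k) (s : Fin σ) → u ≢ w → label G u w ≡ nothing →
        Σ (Graph k) λ G′ → Adds G G′ u w s
  add G u w s u≢w eq = relabel G u w u≢w (just s) , record
    { before = eq
    ; after = relabel-at G u w u≢w (just s)
    ; same = relabel-off G u w u≢w (just s) }

  label⇒≢ : (G : Graph k) {u w : Fin k} {s : Fin σ} → label G u w ≡ just s → u ≢ w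
  label⇒≢ G eq refl with () ← trans (sym (irrefl G _)) eq

  remove : (G : Graph k) (u w : Fin k) (s : Fin σ) → label G u w ≡ just s →
           Σ (Graph k) λ G′ → Adds G′ G u w s
  remove G u w s eq = relabel G u w u≢w nothing , record
    { before = relabel-at G u w u≢w nothing
    ; after = eq
    ; same = λ a b p q → sym (relabel-off G u w u≢w nothing a b p q) }
    where u≢w = label⇒≢ G eq

  incr : Fin k → Fin k → Fin σ → Fin k → Fin σ → ℕ
  incr u w s a t = δ a u * δ t s + δ a w * δ t (flip s)

  -- Only the entries `u`-`w` and `w`-`u` change. Writing the change of each entry with the factors
  -- `δ b w` and `δ b u` lets `sum-δ` evaluate the sum over `b`.
  deg-adds : {G G′ : Graph k} {u w : Fin k} {s : Fin σ} → Adds G G′ u w s →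
             ∀ t a → deg G′ t a ≡ deg G t a + incr u w s a t
  deg-adds {k} {G} {G′} {u} {w} {s} A t a = begin
    sum (λ b → hit t (label G′ a b))
      ≡⟨ sum-cong-≗ entry ⟩
    sum (λ b → hit t (label G a b) + (δ b w * (δ a u * δ t s) + δ b u * (δ a w * δ t (flip s))))
      ≡⟨ ∑-distrib-+ (λ b → hit t (label G a b)) _ ⟩
    deg G t a + sum (λ b → δ b w * (δ a u * δ t s) + δ b u * (δ a w * δ t (flip s)))
      ≡⟨ cong (deg G t a +_) (∑-distrib-+ (λ b → δ b w * (δ a u * δ t s)) _) ⟩
    deg G t a + (sum (λ b → δ b w * (δ a u * δ t s)) + sum (λ b → δ b u * (δ a w * δ t (flip s))))
      ≡⟨ cong (deg G t a +_) (cong₂ _+_ (sum-δ w (λ _ → δ a u * δ t s)) (sum-δ u (λ _ → δ a w * δ t (flip s)))) ⟩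
    deg G t a + (δ a u * δ t s + δ a w * δ t (flip s)) ∎
    where
    open ≡-Reasoning
    u≢w : u ≢ w
    u≢w = label⇒≢ G′ (after A)
    mirror : (H : Graph k) {x : Label} → label H u w ≡ x → label H w u ≡ map flip x
    mirror H eq = trans (symm H u w) (cong (map flip) eq)
    entry : ∀ b → hit t (label G′ a b) ≡
                  hit t (label G a b) + (δ b w * (δ a u * δ t s) + δ b u * (δ a w * δ t (flip s)))
    entry b with a ≟ u | b ≟ w | a ≟ w | b ≟ u
    ... | yes refl | _ | yes refl | _ = contradiction refl u≢w
    ... | _ | yes refl | _ | yes refl = contradiction refl u≢w
    ... | yes refl | yes refl | no _ | no _ rewrite after A | before A = one (δ t s)
      where one : ∀ x → x ≡ x + 0 + 0 + 0
            one = solve-∀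
    ... | yes _ | no b≢w | no a≢w | yes _ = trans (cong (hit t) (same A a b (b≢w ∘ proj₂) (a≢w ∘ proj₁))) (sym (+-identityʳ _))
    ... | yes _ | no b≢w | no a≢w | no _ = trans (cong (hit t) (same A a b (b≢w ∘ proj₂) (a≢w ∘ proj₁))) (sym (+-identityʳ _))
    ... | no a≢u | yes _ | yes _ | no b≢u = trans (cong (hit t) (same A a b (a≢u ∘ proj₁) (b≢u ∘ proj₂))) (sym (+-identityʳ _))
    ... | no a≢u | yes _ | no a≢w | no _ = trans (cong (hit t) (same A a b (a≢u ∘ proj₁) (a≢w ∘ proj₁))) (sym (+-identityʳ _))
    ... | no _ | no _ | yes refl | yes refl rewrite mirror G′ (after A) | mirror G (before A) = one (δ t (flip s))
      where one : ∀ x → x ≡ x + 0 + 0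
            one = solve-∀
    ... | no a≢u | no _ | yes _ | no b≢u = trans (cong (hit t) (same A a b (a≢u ∘ proj₁) (b≢u ∘ proj₂))) (sym (+-identityʳ _))
    ... | no a≢u | no _ | no a≢w | yes _ = trans (cong (hit t) (same A a b (a≢u ∘ proj₁) (a≢w ∘ proj₁))) (sym (+-identityʳ _))
    ... | no a≢u | no _ | no a≢w | no _ = trans (cong (hit t) (same A a b (a≢u ∘ proj₁) (a≢w ∘ proj₁))) (sym (+-identityʳ _))

  -- Replacing the edge x–y by u–y and x–v leaves the degrees of x and y unchanged.
  switch : (G : Graph k) (u v x y : Fin k) (s : Fin σ) → label G x y ≡ just s →
           u ≢ y → label G u y ≡ nothing → x ≢ v → label G x v ≡ nothing →
           Σ (Graph k) λ G′ → ∀ t a → deg G′ t a ≡ deg G t a + incr u v s a t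
  switch G u v x y s xy u≢y uy x≢v xv =
    let x≢y = label⇒≢ G xy
        G₁ , A₁ = remove G x y s xy
        u≢x = λ { refl → nothing≢just (trans (sym uy) xy) }
        v≢y = λ { refl → nothing≢just (trans (sym xv) xy) }
        uy₁ = trans (sym (same A₁ u y (u≢x ∘ proj₁) (u≢y ∘ proj₁))) uy
        xv₁ = trans (sym (same A₁ x v (v≢y ∘ proj₂) (x≢y ∘ proj₁))) xv
        G₂ , A₂ = add G₁ u y s u≢y uy₁
        xv₂ = trans (same A₂ x v (u≢x ∘ sym ∘ proj₁) (x≢y ∘ proj₁)) xv₁
        G₃ , A₃ = add G₂ x v s x≢v xv₂
    in G₃ , λ t a → begin
      deg G₃ t a
        ≡⟨ deg-adds A₃ t a ⟩
      deg G₂ t a + incr x v s a t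
        ≡⟨ cong (_+ incr x v s a t) (deg-adds A₂ t a) ⟩
      deg G₁ t a + incr u y s a t + incr x v s a t
        ≡⟨ rearrange (deg G₁ t a) (δ a u * δ t s) (δ a y * δ t (flip s)) (δ a x * δ t s) (δ a v * δ t (flip s)) ⟩
      deg G₁ t a + incr x y s a t + incr u v s a t
        ≡⟨ cong (_+ incr u v s a t) (deg-adds A₁ t a) ⟨
      deg G t a + incr u v s a t ∎
    where
    open ≡-Reasoning
    nothing≢just : {p : Fin σ} → nothing ≢ just p
    nothing≢just ()
    rearrange : ∀ d p q r z → d + (p + q) + (r + z) ≡ d + (r + q) + (p + z)
    rearrange = solve-∀

  incr-left : ∀ (u w : Fin k) s → 1 ≤ incr u w s u s
  incr-left u w s rewrite δ-refl u | δ-refl s = s≤s z≤n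

  incr-bound : ∀ {u w : Fin k} {s a t} → ¬ (a ≡ w × t ≡ flip s) → incr u w s a t ≤ δ a u * δ t s
  incr-bound {u = u} {w} {s} {a} {t} ¬w with a ≟ w | t ≟ flip s
  ... | yes p | yes q = contradiction (p , q) ¬w
  ... | yes _ | no _ = ≤-reflexive (+-identityʳ _)
  ... | no _ | _ = ≤-reflexive (+-identityʳ _)

  -- Since `flip s` differs from `s`, the two raised entries are distinct even if `u` and `v`
  -- coincide, so none grows by more than one.
  incr-fits : (h f : Fin σ → Fin k → ℕ) {u v : Fin k} {s : Fin σ} → (∀ t a → h t a ≤ f t a) →
              h s u < f s u → h (flip s) v < f (flip s) v → ∀ t a → h t a + incr u v s a t ≤ f t a
  incr-fits h f {u} {v} {s} h≤f hu hv t a with t ≟ s | a ≟ u | t ≟ flip s | a ≟ v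
  ... | yes refl | _ | yes t≡ | _ = contradiction (sym t≡) (flip≢ _)
  ... | yes refl | yes refl | no _ | yes _ = <⇒+1≤ hu
  ... | yes refl | yes refl | no _ | no _ = <⇒+1≤ hu
  ... | yes refl | no _ | no _ | yes _ = ≤⇒+0≤ (h≤f t a)
  ... | yes refl | no _ | no _ | no _ = ≤⇒+0≤ (h≤f t a)
  ... | no _ | yes _ | yes refl | yes refl = <⇒+1≤ hv
  ... | no _ | no _ | yes refl | yes refl = <⇒+1≤ hv
  ... | no _ | yes _ | yes _ | no _ = ≤⇒+0≤ (h≤f t a)
  ... | no _ | no _ | yes _ | no _ = ≤⇒+0≤ (h≤f t a)
  ... | no _ | yes _ | no _ | yes _ = ≤⇒+0≤ (h≤f t a)
  ... | no _ | yes _ | no _ | no _ = ≤⇒+0≤ (h≤f t a)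
  ... | no _ | no _ | no _ | yes _ = ≤⇒+0≤ (h≤f t a)
  ... | no _ | no _ | no _ | no _ = ≤⇒+0≤ (h≤f t a)

  -- Deficits and greedy saturation

  deficit : (f : Fin σ → Fin k → ℕ) → Graph k → Fin k → ℕ
  deficit f G a = sum (λ t → f t a ∸ deg G t a)

  module _ {k} (f : Fin σ → Fin k → ℕ) {G G′ : Graph k} {u w : Fin k} {s : Fin σ}
           (eq : ∀ t a → deg G′ t a ≡ deg G t a + incr u w s a t) where

    -- The assumption `eq` speaks of degrees only, so these facts apply to a switch as well as to a
    -- plain addition.
    deg-mono : ∀ t a → deg G t a ≤ deg G′ t a
    deg-mono t a = subst (deg G t a ≤_) (sym (eq t a)) (m≤m+n (deg G t a) _)

    deficit-≤ : ∀ a → deficit f G′ a ≤ deficit f G a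
    deficit-≤ a = sum-mono λ t → ∸-monoʳ-≤ (f t a) (deg-mono t a)

    deficit-< : deg G s u < f s u → deficit f G′ u < deficit f G u
    deficit-< lt = sum-mono-< (λ t → ∸-monoʳ-≤ (f t u) (deg-mono t u)) s (∸-strictʳ deg< lt)
      where
      deg< : deg G s u < deg G′ s u
      deg< = subst (deg G s u <_) (sym (eq s u)) (m<m+n (deg G s u) (incr-left u w s))

  module _ {k} (f : Fin σ → Fin k → ℕ) (Δ : ℕ) (f≤Δ : ∀ a → sum (λ t → f t a) ≤ Δ) where

    -- The closed neighbourhood of `u` as a weight: it vanishes exactly at those `w` that an edge
    -- from `u` may be added to.
    near : Graph k → Fin k → Fin k → ℕ
    near G u w = δ w u + adj (label G u w)

    near≡0 : (G : Graph k) {u w : Fin k} → near G u w ≡ 0 → u ≢ w × label G u w ≡ nothing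
    near≡0 G {u} {w} eq =
      (δ≡0⇒≢ (m+n≡0⇒m≡0 _ eq) ∘ sym) , adj≡0 _ (m+n≡0⇒n≡0 (δ w u) eq)

    Below : Graph k → Set
    Below G = ∀ t a → deg G t a ≤ f t a

    sum-near : (G : Graph k) → Below G → ∀ u → sum (near G u) ≤ suc Δ
    sum-near G below u = begin
      sum (λ w → δ w u + adj (label G u w))
        ≡⟨ ∑-distrib-+ (λ w → δ w u) (λ w → adj (label G u w)) ⟩
      sum (λ w → δ w u) + sum (λ w → adj (label G u w))
        ≡⟨ cong₂ _+_ (sum-δ-1 u) (sym (sum-deg G u)) ⟩
      1 + sum (λ t → deg G t u)
        ≤⟨ s≤s (≤-trans (sum-mono (λ t → below t u)) (f≤Δ u)) ⟩
      suc Δ ∎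
      where open ≤-Reasoning

    -- Two successive steps within closed neighbourhoods, each with at most `suc Δ` choices.
    sum-near² : (G : Graph k) → Below G → ∀ v →
                sum (λ w → sum (λ x → near G v x * near G x w)) ≤ suc Δ * suc Δ
    sum-near² G below v = begin
      sum (λ w → sum (λ x → near G v x * near G x w))
        ≡⟨ ∑-comm (λ w x → near G v x * near G x w) ⟩
      sum (λ x → sum (λ w → near G v x * near G x w))
        ≡⟨ sum-cong-≗ (λ x → *-distribˡ-sum (near G v x) (near G x)) ⟨
      sum (λ x → near G v x * sum (near G x))
        ≤⟨ sum-mono (λ x → *-monoʳ-≤ (near G v x) (sum-near G below x)) ⟩
      sum (λ x → near G v x * suc Δ)
        ≡⟨ *-distribʳ-sum (suc Δ) (near G v) ⟨
      sum (near G v) * suc Δ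
        ≤⟨ *-monoˡ-≤ (suc Δ) (sum-near G below v) ⟩
      suc Δ * suc Δ ∎
      where open ≤-Reasoning

    -- Some w of positive (flip s)-requirement is neither near u nor near a vertex near v.
    -- If w has no (flip s)-edge yet, it takes the place of v; otherwise such an edge
    -- x–w is switched.
    augment : (G : Graph k) → Below G → ∀ s u v → deg G s u < f s u → deg G (flip s) v < f (flip s) v →
              suc Δ + suc Δ * suc Δ < sum (λ w → pos (f (flip s) w)) →
              Σ (Graph k) λ G′ → Σ (Fin k) λ v′ → deg G (flip s) v′ < f (flip s) v′ ×
                (∀ t a → deg G′ t a ≡ deg G t a + incr u v′ s a t)
    augment G below s u v hu hv large
      -- The obstructions have total weight at most `suc Δ + suc Δ * suc Δ`, less than the number of
      -- candidates, so at some candidate their weight is 0.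
      with w , far<pos ← sum-pick (λ w → near G u w + sum (λ x → near G v x * near G x w)) (λ w → pos (f (flip s) w))
             (≤-<-trans (≤-trans (≤-reflexive (∑-distrib-+ (near G u) (λ w → sum (λ x → near G v x * near G x w)))) (+-mono-≤ (sum-near G below u) (sum-near² G below v))) large)
      with far≡0 , f>0 ← <pos⁻ far<pos
      with u≢w , uw ← near≡0 G (m+n≡0⇒m≡0 (near G u w) far≡0)
      with >0⊎≡0 (deg G (flip s) w)
    ... | inj₂ d≡0 =
      let G′ , A = add G u w s u≢w uw
      in G′ , w , subst (_< f (flip s) w) (sym d≡0) f>0 , deg-adds A
    ... | inj₁ d>0
      with x , hit-x ← sum-witness (λ x → hit (flip s) (label G w x)) d>0 =
      let wx : label G w x ≡ just (flip s)
          wx = hit>0 (label G w x) hit-x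
          xw : label G x w ≡ just s
          xw = trans (symm G w x) (trans (cong (map flip) wx) (cong just (flip-flip s)))
          -- As `x` is adjacent to `w`, the vanishing product puts `x` outside the closed
          -- neighbourhood of `v`: the edge `x`-`v` needed for the switch is free.
          vx*xw : near G v x * near G x w ≡ 0
          vx*xw = sum≡0⇒≡0 (λ x → near G v x * near G x w) (m+n≡0⇒n≡0 (near G u w) far≡0) x
          vx : near G v x ≡ 0
          vx = zero-factor (near G v x) vx*xw (subst (λ l → 0 < δ w x + adj l) (sym xw) (m≤n+m 1 (δ w x)))
          v≢x , vx-none = near≡0 G vx
          G′ , eq = switch G u v x w s xw u≢w uw (v≢x ∘ sym) (trans (symm G v x) (cong (map flip) vx-none))
      in G′ , v , hv , eq

    Saturated : Graph k → Set
    Saturated G = ∀ s u v → deg G s u < f s u → ¬ deg G (flip s) v < f (flip s) v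

    -- Augmentation repeats while some slot and its reverse both have deficits; every round lowers
    -- the total deficit. A deficit presupposes a positive requirement, which rules out the first
    -- alternative of the hypothesis.
    saturate : (∀ s → sum (λ w → pos (f s w)) ≡ 0 ⊎ suc Δ + suc Δ * suc Δ < sum (λ w → pos (f s w))) →
               Σ (Graph k) λ G → Below G × Saturated G
    saturate large =
      let (G , below) , sat = iterate (λ { (G , _) → sum (deficit f G) }) step
                                (empty , λ t a → subst (_≤ f t a) (sym (deg-empty t a)) z≤n)
      in G , below , sat
      where
      step : (st : Σ (Graph k) Below) →
             Saturated (proj₁ st) ⊎ Σ (Σ (Graph k) Below) λ st′ → sum (deficit f (proj₁ st′)) < sum (deficit f (proj₁ st))
      step (G , below) with any? (λ s → any? λ u → any? λ v → (deg G s u <? f s u) ×-dec (deg G (flip s) v <? f (flip s) v))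
      ... | no ¬aug = inj₁ λ s u v hu hv → ¬aug (s , u , v , hu , hv)
      ... | yes (s , u , v , hu , hv) with large (flip s)
      ...   | inj₁ Σ≡0 with () ← ≤-trans (<⇒1≤pos hv) (≤-reflexive (sum≡0⇒≡0 (λ w → pos (f (flip s) w)) Σ≡0 v))
      ...   | inj₂ big =
        let G′ , v′ , hv′ , eq = augment G below s u v hu hv big
        in inj₂ ((G′ , λ t a → subst (_≤ f t a) (sym (eq t a)) (incr-fits (deg G) f below hu hv′ t a)) ,
                 sum-mono-< (deficit-≤ f {G} {G′} eq) u (deficit-< f {G} {G′} eq hu))

  -- Realizing requirements by completion over three levels

  Req : Set
  Req = Fin σ → 𝔹

  Realizable : (Fin k → Req) → Set
  Realizable {k} R = Σ (Graph k) λ G → ∀ v s → deg G s v ≐ R v s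

  adj≤1 : ∀ x → adj x ≤ 1
  adj≤1 nothing = z≤n
  adj≤1 (just _) = s≤s z≤n

  module Completion {k} (R : Fin k → Req) (Δ : ℕ) (level : Fin k → Fin 3)
    (receivers : ∀ s b → sum (λ v → isAtLeast (R v s)) ≡ 0 ⊎
       (Σ (Fin (suc Δ) → Fin k) λ g → (∀ {i j} → g i ≡ g j → i ≡ j) ×
          (∀ i → isAtLeast (R (g i) s) ≡ 1) × (∀ i → level (g i) ≡ b))) where

    f : Fin σ → Fin k → ℕ
    f s v = lb (R v s)

    fwd : Graph k → Fin k → Fin k → ℕ
    fwd G u w = δ (level w) (next (level u)) * adj (label G u w)

    -- Every vertex u completes its own deficits with edges to the next level only.
    -- Edges received by u come from the previous level, hence do not obstruct this,
    -- however many there are.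
    record Partial : Set where
      field
        graph   : Graph k
        capped  : ∀ s v → isAtLeast (R v s) ≡ 0 → deg graph s v ≤ f s v
        room    : ∀ u → sum (fwd graph u) + deficit f graph u ≤ Δ
        targets : ∀ s u → deg graph s u < f s u → 0 < sum (λ v → isAtLeast (R v (flip s)))

    open Partial

    -- At `u` one more forward edge is paid for by a smaller deficit, so `room` persists. At `w` the
    -- edge is not a forward one, and the slot it uses is unbounded there, so `capped` persists too.
    extend-along : (S : Partial) {s : Fin σ} {u w : Fin k} {G′ : Graph k} → deg (graph S) s u < f s u →
                   isAtLeast (R w (flip s)) ≡ 1 → level w ≡ next (level u) → Adds (graph S) G′ u w s →
                   Σ Partial λ S′ → sum (deficit f (graph S′)) < sum (deficit f (graph S))
    extend-along S {s} {u} {w} {G′} lt w-open w-level A =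
      S′ , sum-mono-< (deficit-≤ f {G} {G′} eq) u (deficit-< f {G} {G′} eq lt)
      where
      G : Graph k
      G = graph S
      u≢w : u ≢ w
      u≢w = label⇒≢ G′ (after A)
      eq : ∀ t a → deg G′ t a ≡ deg G t a + incr u w s a t
      eq = deg-adds A

      capped′ : ∀ t a → isAtLeast (R a t) ≡ 0 → deg G′ t a ≤ f t a
      capped′ t a exact = ≤-trans (≤-reflexive (eq t a)) (≤-trans (+-monoʳ-≤ (deg G t a) (incr-bound not-target)) fits)
        where
        not-target : ¬ (a ≡ w × t ≡ flip s)
        not-target (refl , refl) = contradiction (trans (sym exact) (w-open)) (λ ())
        fits : deg G t a + δ a u * δ t s ≤ f t a
        fits with a ≟ u | t ≟ s
        ... | yes refl | yes refl = <⇒+1≤ lt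
        ... | yes _ | no _ = ≤⇒+0≤ (capped S t a exact)
        ... | no _ | _ = ≤⇒+0≤ (capped S t a exact)

      fwd-u : ∀ b → fwd G′ u b ≤ fwd G u b + δ b w
      fwd-u b with b ≟ w
      ... | yes _ = ≤-trans (*-mono-≤ (δ≤1 (level b) (next (level u))) (adj≤1 (label G′ u b))) (m≤n+m 1 _)
      ... | no b≢w = ≤-trans (≤-reflexive (cong (λ x → δ (level b) (next (level u)) * adj x) (same A u b (b≢w ∘ proj₂) (u≢w ∘ proj₁)))) (m≤m+n _ _)

      fwd-other : ∀ a → a ≢ u → ∀ b → fwd G′ a b ≤ fwd G a b
      fwd-other a a≢u b with a ≟ w | b ≟ u
      ... | yes refl | yes refl =
        -- Seen from `w`, the vertex `u` would have to lie two levels after itself; the weight is 0.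
        ≤-trans (≤-reflexive (cong (_* adj (label G′ a b)) (δ-≢ (λ e → next²≢ (level b) (trans (cong next (sym (w-level))) (sym e)))))) z≤n
      ... | yes _ | no b≢u = ≤-reflexive (cong (λ x → δ (level b) (next (level a)) * adj x) (same A a b (a≢u ∘ proj₁) (b≢u ∘ proj₂)))
      ... | no a≢w | _ = ≤-reflexive (cong (λ x → δ (level b) (next (level a)) * adj x) (same A a b (a≢u ∘ proj₁) (a≢w ∘ proj₁)))

      room′ : ∀ a → sum (fwd G′ a) + deficit f G′ a ≤ Δ
      room′ a with a ≟ u
      ... | no a≢u = ≤-trans (+-mono-≤ (sum-mono (fwd-other a a≢u)) (deficit-≤ f {G} {G′} eq a)) (room S a)
      ... | yes refl = begin
        sum (fwd G′ u) + deficit f G′ u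
          ≤⟨ +-monoˡ-≤ _ (sum-mono fwd-u) ⟩
        sum (λ b → fwd G u b + δ b w) + deficit f G′ u
          ≡⟨ cong (_+ deficit f G′ u) (trans (∑-distrib-+ (fwd G u) (λ b → δ b w)) (cong (sum (fwd G u) +_) (sum-δ-1 w))) ⟩
        sum (fwd G u) + 1 + deficit f G′ u
          ≡⟨ +-assoc (sum (fwd G u)) 1 _ ⟩
        sum (fwd G u) + suc (deficit f G′ u)
          ≤⟨ +-monoʳ-≤ (sum (fwd G u)) (deficit-< f {G} {G′} eq lt) ⟩
        sum (fwd G u) + deficit f G u
          ≤⟨ room S u ⟩
        Δ ∎
        where open ≤-Reasoning

      S′ : Partial
      S′ = record
        { graph = G′
        ; capped = capped′
        ; room = room′
        ; targets = λ t a lt′ → targets S t a (≤-<-trans (deg-mono f {G} {G′} eq t a) lt′) }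

    -- By `room`, at most `Δ` forward edges leave `u`, while the next level has `suc Δ` receivers;
    -- one of them is not yet joined to `u`.
    extend : (S : Partial) → ∀ s u → deg (graph S) s u < f s u →
             Σ Partial λ S′ → sum (deficit f (graph S′)) < sum (deficit f (graph S))
    extend S s u lt with receivers (flip s) (next (level u))
    ... | inj₁ ≡0 = contradiction (subst (0 <_) ≡0 (targets S s u lt)) (λ ())
    ... | inj₂ (g , inj , g-open , g-level)
      with i , free ← sum-pick (fwd (graph S) u ∘ g) (λ _ → 1)
             (subst (sum (fwd (graph S) u ∘ g) <_) (sym (sum-ones (suc Δ)))
               (s≤s (≤-trans (sum-∘-injective g inj (fwd (graph S) u)) (≤-trans (m≤m+n _ _) (room S u)))))
      = extend-along S lt (g-open i) (g-level i) (proj₂ (add (graph S) u (g i) s u≢w unjoined))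
      where
      unjoined : label (graph S) u (g i) ≡ nothing
      unjoined = adj≡0 _ (trans (sym (*-identityˡ _)) (trans
        (cong (_* adj (label (graph S) u (g i))) (sym (trans (cong (λ b → δ b (next (level u))) (g-level i)) (δ-refl (next (level u))))))
        (n<1⇒n≡0 free)))
      u≢w : u ≢ g i
      u≢w u≡w = next≢ (level u) (trans (sym (g-level i)) (cong level (sym u≡w)))

    complete-partial : Partial → Realizable R
    complete-partial S₀ =
      let S , full = iterate (λ S → sum (deficit f (graph S))) step S₀
      in graph S , λ v s → meets (R v s) (full s v) (capped S s v)
      where
      meets : ∀ b {x} → lb b ≤ x → (isAtLeast b ≡ 0 → x ≤ lb b) → x ≐ b
      meets (exactly d) d≤x cap = ≤-antisym (cap refl) d≤x
      meets (atLeast d) d≤x _ = d≤x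
      step : (S : Partial) → (∀ s u → f s u ≤ deg (graph S) s u) ⊎
             Σ Partial λ S′ → sum (deficit f (graph S′)) < sum (deficit f (graph S))
      step S with any? (λ s → any? λ u → deg (graph S) s u <? f s u)
      ... | yes (s , u , lt) = inj₂ (extend S s u lt)
      ... | no full = inj₁ λ s u → ≮⇒≥ (λ lt → full (s , u , lt))

  -- The first summand is what saturation needs, its leading `suc` making the bound strict; the
  -- second provides `suc Δ` receivers for each of `σ` slots and 3 levels.
  threshold : ℕ → ℕ
  threshold Δ = suc (suc Δ + suc Δ * suc Δ) + σ * (3 * suc Δ)

  -- Saturation, then completion. After saturation the degrees and the deficit of a vertex add up to
  -- its lower bounds, hence to at most `Δ`, which gives the initial `room`.
  realize : (R : Fin k → Req) (Δ : ℕ) → (∀ v → sum (λ s → lb (R v s)) ≤ Δ) →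
            (∀ s → sum (λ v → pos (lb (R v s))) ≡ 0 ⊎ threshold Δ ≤ sum (λ v → pos (lb (R v s)))) →
            (∀ s → sum (λ v → isAtLeast (R v s)) ≡ 0 ⊎ threshold Δ ≤ sum (λ v → isAtLeast (R v s))) →
            (∀ s → sum (λ v → lb (R v s)) ≤ sum (λ v → lb (R v (flip s))) ⊎ 0 < sum (λ v → isAtLeast (R v (flip s)))) →
            Realizable R
  realize {k} R Δ bound largeW largeU balance
    with G , below , sat ← saturate (λ s v → lb (R v s)) Δ bound (Sum.map₂ (≤-trans (m≤m+n _ _)) ∘ largeW)
    with level , receivers ← levels (suc Δ) (λ s v → isAtLeast (R v s)) (λ s v → isAtLeast≤1 (R v s))
           (Sum.map₂ (≤-trans (m≤n+m _ _)) ∘ largeU)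
    = complete-partial record
        { graph = G
        ; capped = λ s v _ → below s v
        ; room = room₀
        ; targets = targets₀ }
    where
    open Completion R Δ level receivers
    room₀ : ∀ u → sum (fwd G u) + deficit f G u ≤ Δ
    room₀ u = begin
      sum (fwd G u) + deficit f G u
        ≤⟨ +-monoˡ-≤ (deficit f G u) (sum-mono fwd≤adj) ⟩
      sum (λ w → adj (label G u w)) + deficit f G u
        ≡⟨ cong (_+ deficit f G u) (sum-deg G u) ⟨
      sum (λ t → deg G t u) + deficit f G u
        ≡⟨ ∑-distrib-+ (λ t → deg G t u) (λ t → f t u ∸ deg G t u) ⟨
      sum (λ t → deg G t u + (f t u ∸ deg G t u))
        ≡⟨ sum-cong-≗ (λ t → m+[n∸m]≡n (below t u)) ⟩
      sum (λ t → f t u)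
        ≤⟨ bound u ⟩
      Δ ∎
      where
      open ≤-Reasoning
      fwd≤adj : ∀ w → fwd G u w ≤ adj (label G u w)
      fwd≤adj w = subst (fwd G u w ≤_) (*-identityˡ _) (*-monoˡ-≤ (adj (label G u w)) (δ≤1 (level w) (next (level u))))
    targets₀ : ∀ s u → deg G s u < f s u → 0 < sum (λ v → isAtLeast (R v (flip s)))
    targets₀ s u lt with balance s
    ... | inj₂ some = some
    -- A deficit in slot `s` means that slot `flip s` is full at every vertex. By the handshake the
    -- lower bounds for `s` then sum to strictly more than those for `flip s`.
    ... | inj₁ le = contradiction le (<⇒≱ (begin-strict
      sum (f (flip s))        ≡⟨ sum-cong-≗ (λ v → ≤-antisym (≮⇒≥ (sat s u v lt)) (below (flip s) v)) ⟩
      sum (deg G (flip s))    ≡⟨ handshake G s ⟨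
      sum (deg G s)           <⟨ sum-mono-< (below s) u lt ⟩
      sum (f s)               ∎))
      where open ≤-Reasoning

  -- Partitioned graphs and kinds of vertices

  record Reg (B : Fin m → Req) (N : Env m) : Set where
    constructor reg
    field
      {order}  : ℕ
      part     : Fin order → Fin m
      counts   : Counts part N
      real     : Realizable (B ∘ part)

  open Reg

  Reg-cong : {B : Fin m → Req} {N N′ : Env m} → N ≗ N′ → Reg B N → Reg B N′
  Reg-cong eq (reg part counts real) = reg part (λ j → trans (counts j) (eq j)) real

  -- Agreement is asked at the parts of actual vertices only, so requirements of empty parts can be
  -- replaced.
  Reg-transport : {B B′ : Fin m → Req} {N : Env m} (r : Reg B N) →
                  (∀ v → B (part r v) ≗ B′ (part r v)) → Reg B′ N
  Reg-transport (reg part counts (G , degs)) eq =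
    reg part counts (G , λ v s → subst (deg G s v ≐_) (eq v s) (degs v s))

  kind : Fin (σ + σ) → Req → ℕ
  kind q r = [ (λ s → pos (lb (r s))) , (λ s → isAtLeast (r s)) ]′ (splitAt σ q)

  kind-W : ∀ s r → kind (s ↑ˡ σ) r ≡ pos (lb (r s))
  kind-W s r rewrite splitAt-↑ˡ σ s σ = refl

  kind-U : ∀ s r → kind (σ ↑ʳ s) r ≡ isAtLeast (r s)
  kind-U s r rewrite splitAt-↑ʳ σ σ s = refl

  -- Lowering may turn a positive bound into 0 but not conversely, and it keeps exact and unbounded
  -- requirements apart. Hence removing vertices never creates a kind.
  kind-lower : ∀ q (r : Req) (h : Fin σ → ℕ) → kind q (λ s → lower (h s) (r s)) ≤ kind q r
  kind-lower q r h with splitAt σ q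
  ... | inj₁ s = pos-mono (lb-lower (h s) (r s))
  ... | inj₂ s = ≤-reflexive (isAtLeast-lower (h s) (r s))

  kind-isolated : ∀ q → kind q (λ _ → exactly 0) ≡ 0
  kind-isolated q with splitAt σ q
  ... | inj₁ s = refl
  ... | inj₂ s = refl

  size : {B : Fin m → Req} {N : Env m} → Fin (σ + σ) → Reg B N → ℕ
  size {B = B} q r = sum (λ v → kind q (B (part r v)))

  Reg≤ : Fin (σ + σ) → ℕ → (Fin m → Req) → Env m → Set
  Reg≤ q c B N = Σ (Reg B N) λ r → size q r ≤ c

  -- Removing and inserting a vertex

  encode : Label → Fin (suc σ)
  encode nothing = zero
  encode (just s) = suc s

  decode : Fin (suc σ) → Label
  decode zero = nothing
  decode (suc s) = just s

  decode-encode : ∀ x → decode (encode x) ≡ x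
  decode-encode nothing = refl
  decode-encode (just s) = refl

  -- When a vertex x is removed, a vertex v of part j moves to part refine j (label x v).
  base : Fin (m * suc σ) → Fin m
  base i = proj₁ (remQuot (suc σ) i)

  lab : Fin (m * suc σ) → Label
  lab {m} i = decode (proj₂ (remQuot {m} (suc σ) i))

  refine : Fin m → Label → Fin (m * suc σ)
  refine j x = combine j (encode x)

  base-refine : ∀ (j : Fin m) x → base (refine j x) ≡ j
  base-refine j x = cong proj₁ (remQuot-combine j (encode x))

  lab-refine : ∀ (j : Fin m) x → lab {m} (refine j x) ≡ x
  lab-refine j x = trans (cong (decode ∘ proj₂) (remQuot-combine j (encode x))) (decode-encode x)

  -- The loss of `s`-degree at a vertex of part `i` when `x` is removed. The part records the label
  -- as seen from `x`, whence the flip.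
  back : Fin (m * suc σ) → Fin σ → ℕ
  back {m} i s = hit s (map flip (lab {m} i))

  residual : (Fin m → Req) → Fin (m * suc σ) → Req
  residual {m} B i s = lower (back {m} i s) (B (base i) s)

  -- The refined parts record all edges at the removed vertex of part `j`, so its degrees are linear
  -- in `M`, as are the old part sizes. The last clause forbids exact requirements overdrawn by the
  -- removed edge, except in empty parts.
  Removed : (Fin m → Req) → Fin m → Env m → Env (m * suc σ) → Set
  Removed {m} B j N M =
      (∀ j′ → sum (λ i → δ (base i) j′ * M i) + δ j j′ ≡ N j′)
    × (∀ s → sum (λ i → hit s (lab {m} i) * M i) ≐ B j s)
    × (∀ i s → Feasible (back {m} i s) (B (base i) s) ⊎ M i ≡ 0)

  -- The refined part of each vertex dictates its edge to the new vertex.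
  insert-vertex : {B : Fin m → Req} {j : Fin m} {N : Env m} {M : Env (m * suc σ)} →
                  Removed B j N M → Reg (residual B) M → Reg B N
  insert-vertex {m} {B} {j} {N} {M} (sizes , degree , feasible) (reg {k} part counts (G , degs)) =
    reg part⁺ counts⁺ (G⁺ , degs⁺)
    where
    part⁺ : Fin (suc k) → Fin m
    part⁺ zero = j
    part⁺ (suc v) = base (part v)
    counts⁺ : Counts part⁺ N
    counts⁺ j′ = trans (+-comm (δ j j′) _)
      (trans (cong (_+ δ j j′) (sym (weighted-sum part counts (λ i → δ (base i) j′)))) (sizes j′))
    ℓ : Fin (suc k) → Fin (suc k) → Label
    ℓ zero zero = nothing
    ℓ zero (suc v) = lab {m} (part v)
    ℓ (suc u) zero = map flip (lab {m} (part u))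
    ℓ (suc u) (suc v) = label G u v
    G⁺ : Graph (suc k)
    G⁺ = record
      { label = ℓ
      ; irrefl = λ { zero → refl ; (suc v) → irrefl G v }
      ; symm = λ { zero zero → refl
                 ; zero (suc v) → refl
                 ; (suc u) zero → sym (map-flip-flip _)
                 ; (suc u) (suc v) → symm G u v } }
    degs⁺ : ∀ v s → deg G⁺ s v ≐ B (part⁺ v) s
    degs⁺ zero s = subst (_≐ B j s) (weighted-sum part counts (λ i → hit s (lab {m} i))) (degree s)
    degs⁺ (suc v) s with feasible (part v) s
    ... | inj₁ feas = ≐-raise (B (base (part v)) s) feas (degs v s)
    ... | inj₂ M≡0 = contradiction M≡0 (inhabited part counts v)

  module _ {B : Fin m → Req} {N : Env m} {k : ℕ} (part : Fin (suc k) → Fin m) (counts : Counts part N)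
           (G : Graph (suc k)) (degs : ∀ v s → deg G s v ≐ B (part v) s) (x : Fin (suc k)) where

    part⁻ : Fin k → Fin (m * suc σ)
    part⁻ v = refine (part (punchIn x v)) (label G x (punchIn x v))

    G⁻ : Graph k
    G⁻ = record
      { label = λ u v → label G (punchIn x u) (punchIn x v)
      ; irrefl = λ v → irrefl G (punchIn x v)
      ; symm = λ u v → symm G (punchIn x u) (punchIn x v) }

    deg-split : ∀ v s → deg G s (punchIn x v) ≡ back {m} (part⁻ v) s + deg G⁻ s v
    deg-split v s = trans (sum-remove {i = x} (λ u → hit s (label G (punchIn x v) u)))
      (cong (λ l → hit s l + deg G⁻ s v)
        (trans (symm G x (punchIn x v)) (cong (map flip) (sym (lab-refine (part (punchIn x v)) _)))))

    split-≐ : ∀ v s → Feasible (back {m} (part⁻ v) s) (B (base (part⁻ v)) s) × deg G⁻ s v ≐ residual B (part⁻ v) s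
    split-≐ v s = ≐-lower (B (base (part⁻ v)) s)
      (subst (_≐ B (base (part⁻ v)) s) (deg-split v s)
        (subst (λ j → deg G s (punchIn x v) ≐ B j s) (sym (base-refine (part (punchIn x v)) _)) (degs (punchIn x v) s)))

    removed : {M : Env (m * suc σ)} → Counts part⁻ M → Removed B (part x) N M
    removed {M} counts⁻ = sizes , degree , feasible
      where
      sizes : ∀ j → sum (λ i → δ (base i) j * M i) + δ (part x) j ≡ N j
      sizes j = begin
        sum (λ i → δ (base i) j * M i) + δ (part x) j
          ≡⟨ cong (_+ δ (part x) j) (weighted-sum part⁻ counts⁻ (λ i → δ (base i) j)) ⟩
        sum (λ v → δ (base (part⁻ v)) j) + δ (part x) j
          ≡⟨ cong (_+ δ (part x) j) (sum-cong-≗ (λ v → cong (λ i → δ i j) (base-refine (part (punchIn x v)) _))) ⟩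
        sum (λ v → δ (part (punchIn x v)) j) + δ (part x) j
          ≡⟨ +-comm _ (δ (part x) j) ⟩
        δ (part x) j + sum (λ v → δ (part (punchIn x v)) j)
          ≡⟨ sum-remove {i = x} (λ v → δ (part v) j) ⟨
        sum (λ v → δ (part v) j)
          ≡⟨ counts j ⟩
        N j ∎
        where open ≡-Reasoning
      degree : ∀ s → sum (λ i → hit s (lab {m} i) * M i) ≐ B (part x) s
      degree s = subst (_≐ B (part x) s) (sym (begin
        sum (λ i → hit s (lab {m} i) * M i)
          ≡⟨ weighted-sum part⁻ counts⁻ (λ i → hit s (lab {m} i)) ⟩
        sum (λ v → hit s (lab {m} (part⁻ v)))
          ≡⟨ sum-cong-≗ (λ v → cong (hit s) (lab-refine (part (punchIn x v)) _)) ⟩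
        sum (λ v → hit s (label G x (punchIn x v)))
          ≡⟨ cong (λ l → hit s l + sum (λ v → hit s (label G x (punchIn x v)))) (irrefl G x) ⟨
        hit s (label G x x) + sum (λ v → hit s (label G x (punchIn x v)))
          ≡⟨ sum-remove {i = x} (λ v → hit s (label G x v)) ⟨
        deg G s x ∎)) (degs x s)
        where open ≡-Reasoning
      feasible : ∀ i s → Feasible (back {m} i s) (B (base i) s) ⊎ M i ≡ 0
      feasible i s with >0⊎≡0 (M i)
      ... | inj₂ M≡0 = inj₂ M≡0
      ... | inj₁ M>0 with v , δ>0 ← sum-witness (λ v → δ (part⁻ v) i) (subst (0 <_) (sym (counts⁻ i)) M>0)
                     with refl ← δ>0⇒≡ δ>0 = inj₁ (proj₁ (split-≐ v s))

    reg⁻ : {M : Env (m * suc σ)} → Counts part⁻ M → Reg (residual B) M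
    reg⁻ counts⁻ = reg part⁻ counts⁻ (G⁻ , λ v s → proj₂ (split-≐ v s))

    -- The vertex `x` is lost from kind `q`, and by `kind-lower` no other vertex enters it.
    size-reg⁻ : ∀ q {M} (counts⁻ : Counts part⁻ M) → 0 < kind q (B (part x)) →
                size q (reg⁻ counts⁻) < sum (λ v → kind q (B (part v)))
    size-reg⁻ q counts⁻ x∈q = begin-strict
      sum (λ v → kind q (residual B (part⁻ v)))
        ≤⟨ sum-mono (λ v → kind-lower q (B (base (part⁻ v))) (back {m} (part⁻ v))) ⟩
      sum (λ v → kind q (B (base (part⁻ v))))
        ≡⟨ sum-cong-≗ (λ v → cong (kind q ∘ B) (base-refine (part (punchIn x v)) _)) ⟩
      sum (λ v → kind q (B (part (punchIn x v))))
        <⟨ m<n+m _ x∈q ⟩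
      kind q (B (part x)) + sum (λ v → kind q (B (part (punchIn x v))))
        ≡⟨ sum-remove {i = x} (λ v → kind q (B (part v))) ⟨
      sum (λ v → kind q (B (part v))) ∎
      where open ≤-Reasoning

  -- Clearing a kind and defining a removal

  keep : ℕ → Req → Req
  keep zero r = r
  keep (suc _) r _ = exactly 0

  -- Used together with the condition that the parts of kind `q` are empty. It takes the kind out of
  -- the requirements themselves, so that the recursion can drop it.
  clear : Fin (σ + σ) → (Fin m → Req) → Fin m → Req
  clear q B j = keep (kind q (B j)) (B j)

  kind-keep : ∀ q c r → kind q (keep c r) ≤ kind q r
  kind-keep q zero r = ≤-refl
  kind-keep q (suc c) r = subst (_≤ kind q r) (sym (kind-isolated q)) z≤n

  kind-clear : ∀ q (B : Fin m → Req) j → kind q (clear q B j) ≡ 0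
  kind-clear q B j with kind q (B j) in eq
  ... | zero = eq
  ... | suc _ = kind-isolated q

  lb-keep : ∀ c r s → lb (keep c r s) ≤ lb (r s)
  lb-keep zero r s = ≤-refl
  lb-keep (suc c) r s = z≤n

  -- The sizes of the refined parts come first among the variables, where `∃-≬` binds them; the
  -- original sizes follow.
  removed-≬ : (B : Fin m → Req) (j : Fin m) → let P = λ ρ → Removed B j (ρ ∘ (m * suc σ ↑ʳ_)) (ρ ∘ (_↑ˡ m)) in
              Sandwich P P
  removed-≬ {m} B j = ∧-≬
    (⋀-≬ λ j′ → ≡-≬ (+-lin (Σ-lin (λ i → δ (base i) j′) (_↑ˡ m)) (num-lin (δ j j′))) (var-lin (m * suc σ ↑ʳ j′)))
    (∧-≬ (⋀-≬ λ s → ≐-≬ (Σ-lin (λ i → hit s (lab {m} i)) (_↑ˡ m)) (B j s))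
         (⋀-≬ λ i → ⋀-≬ λ s → ∨-≬ (const-≬ (feasible? (back {m} i s) (B (base i) s)))
                                  (≡-≬ (var-lin (i ↑ˡ m)) (num-lin 0))))

  -- Recursion over the kinds

  module _ (Δ : ℕ) where

    Bounded : (Fin m → Req) → Set
    Bounded B = ∀ j → sum (λ s → lb (B j s)) ≤ Δ

    -- Kinds q with L q = 0 do not occur in B; the recursion is on sum L.
    Within : (Fin (σ + σ) → ℕ) → (Fin m → Req) → Set
    Within L B = ∀ q j → kind q (B j) ≤ L q

    -- Induction on `c`: either no vertex of kind `q` exists, or one is guessed and removed. The
    -- formula does not check that the guessed vertex has kind `q`, so it may hold beyond
    -- `Reg≤ q c B`; it still implies `Reg B`, which is why two predicates are needed. The number of
    -- parts grows at each removal, so `m` and `B` vary in the induction.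
    few-≬ : (L : Fin (σ + σ) → ℕ) (q : Fin (σ + σ)) →
            (∀ {m} (B : Fin m → Req) → Bounded B → Within (except q L) B → Sandwich (Reg B) (Reg B)) →
            ∀ c {m} (B : Fin m → Req) → Bounded B → Within L B → Sandwich (Reg≤ q c B) (Reg B)
    few-≬ L q none-≬ zero {m} B bounded within = weaken to from
      (∧-≬ (none-≬ (clear q B) bounded′ within′)
           (⋀-≬ λ j → ∨-≬ (const-≬ (kind q (B j) ℕ.≟ 0)) (≡-≬ (var-lin j) (num-lin 0))))
      where
      bounded′ : Bounded (clear q B)
      bounded′ j = ≤-trans (sum-mono (lb-keep (kind q (B j)) (B j))) (bounded j)
      within′ : Within (except q L) (clear q B)
      within′ q′ j with q′ ≟ q
      ... | yes refl = ≤-reflexive (kind-clear q B j)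
      ... | no _ = ≤-trans (kind-keep q′ (kind q (B j)) (B j)) (within q′ j)
      to : ∀ N → Reg≤ q 0 B N → Reg (clear q B) N × (∀ j → kind q (B j) ≡ 0 ⊎ N j ≡ 0)
      to N (r , size≤0) = Reg-transport r (λ v s → cong (λ c → keep c (B (part r v)) s) (sym (absent v))) , empty-part
        where
        absent : ∀ v → kind q (B (part r v)) ≡ 0
        absent = sum≡0⇒≡0 (λ v → kind q (B (part r v))) (n≤0⇒n≡0 size≤0)
        empty-part : ∀ j → kind q (B j) ≡ 0 ⊎ N j ≡ 0
        empty-part j with >0⊎≡0 (N j)
        ... | inj₂ N≡0 = inj₂ N≡0
        ... | inj₁ N>0 with v , δ>0 ← sum-witness (λ v → δ (part r v) j) (subst (0 <_) (sym (counts r j)) N>0)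
                       with refl ← δ>0⇒≡ δ>0 = inj₁ (absent v)
      from : ∀ N → Reg (clear q B) N × (∀ j → kind q (B j) ≡ 0 ⊎ N j ≡ 0) → Reg B N
      from N (r , empty-part) = Reg-transport r unchanged
        where
        unchanged : ∀ v → clear q B (part r v) ≗ B (part r v)
        unchanged v s with empty-part (part r v)
        ... | inj₁ ≡0 = cong (λ c → keep c (B (part r v)) s) ≡0
        ... | inj₂ N≡0 = contradiction N≡0 (inhabited (part r) (counts r) v)
    few-≬ L q none-≬ (suc c) {m} B bounded within = weaken to from
      (∨-≬ (few-≬ L q none-≬ zero B bounded within)
           (⋁-≬ λ j → ∃-≬ (m * suc σ) (∧-≬ (removed-≬ B j)
             (rename-≬ (_↑ˡ m) (few-≬ L q none-≬ c (residual B) bounded′ within′)))))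
      where
      bounded′ : Bounded (residual B)
      bounded′ i = ≤-trans (sum-mono (λ s → lb-lower (back {m} i s) (B (base i) s))) (bounded (base i))
      within′ : Within L (residual B)
      within′ q′ i = ≤-trans (kind-lower q′ (B (base i)) (back {m} i)) (within q′ (base i))
      to : ∀ N → Reg≤ q (suc c) B N → Reg≤ q 0 B N ⊎ Σ (Fin m) λ j → Σ (Env (m * suc σ + m)) λ ρ →
             (∀ j′ → ρ (m * suc σ ↑ʳ j′) ≡ N j′) ×
             Removed B j (ρ ∘ (m * suc σ ↑ʳ_)) (ρ ∘ (_↑ˡ m)) × Reg≤ q c (residual B) (ρ ∘ (_↑ˡ m))
      to N (r , size≤) with >0⊎≡0 (size q r)
      ... | inj₂ size≡0 = inj₁ (r , ≤-reflexive size≡0)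
      to N (reg {suc k} part counts (G , degs) , size≤) | inj₁ size>0
        with x , x∈q ← sum-witness (λ v → kind q (B (part v))) size>0
        = inj₂ (part x , ρ , ρ-N , removed {B = B} part (λ j → trans (counts j) (sym (ρ-N j))) G degs x ρ-M ,
                reg⁻ {B = B} part counts G degs x ρ-M ,
                s≤s⁻¹ (<-≤-trans (size-reg⁻ {B = B} part counts G degs x q ρ-M x∈q) size≤))
        where
        ρ : Env (m * suc σ + m)
        ρ i = [ (λ i → sum (λ v → δ (part⁻ {B = B} part counts G degs x v) i)) , N ]′ (splitAt (m * suc σ) i)
        ρ-N : ∀ j → ρ (m * suc σ ↑ʳ j) ≡ N j
        ρ-N j rewrite splitAt-↑ʳ (m * suc σ) m j = refl
        ρ-M : Counts (part⁻ {B = B} part counts G degs x) (ρ ∘ (_↑ˡ m))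
        ρ-M i rewrite splitAt-↑ˡ (m * suc σ) i m = refl
      from : ∀ N → Reg B N ⊎ (Σ (Fin m) λ j → Σ (Env (m * suc σ + m)) λ ρ →
               (∀ j′ → ρ (m * suc σ ↑ʳ j′) ≡ N j′) ×
               Removed B j (ρ ∘ (m * suc σ ↑ʳ_)) (ρ ∘ (_↑ˡ m)) × Reg (residual B) (ρ ∘ (_↑ˡ m))) → Reg B N
      from N (inj₁ r) = r
      from N (inj₂ (j , ρ , ρ-N , rem , r)) = Reg-cong ρ-N (insert-vertex rem r)

    Large : (Fin (σ + σ) → ℕ) → (Fin m → Req) → Env m → Set
    Large L B N = ∀ q → L q ≡ 0 ⊎ threshold Δ ≤ sum (λ j → kind q (B j) * N j)

    Balanced : (Fin m → Req) → Env m → Set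
    Balanced B N = ∀ s → sum (λ j → lb (B j s) * N j) ≤ sum (λ j → lb (B j (flip s)) * N j)
                       ⊎ 1 ≤ sum (λ j → isAtLeast (B j (flip s)) * N j)

    -- If no vertex is unbounded in slot `flip s`, all degrees there equal their bounds, and the
    -- handshake compares them with the lower bounds for `s`.
    balanced : {B : Fin m → Req} {N : Env m} → Reg B N → Balanced B N
    balanced {B = B} {N} (reg part counts (G , degs)) s
      with >0⊎≡0 (sum (λ j → isAtLeast (B j (flip s)) * N j))
    ... | inj₁ >0 = inj₂ >0
    ... | inj₂ ≡0 = inj₁ (begin
      sum (λ j → lb (B j s) * N j)
        ≡⟨ weighted-sum part counts (λ j → lb (B j s)) ⟩
      sum (λ v → lb (B (part v) s))
        ≤⟨ sum-mono (λ v → ≐⇒lb≤ (B (part v) s) (degs v s)) ⟩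
      sum (deg G s)
        ≡⟨ handshake G s ⟩
      sum (deg G (flip s))
        ≤⟨ sum-mono (λ v → ≐⇒≤lb (B (part v) (flip s)) (exact v) (degs v (flip s))) ⟩
      sum (λ v → lb (B (part v) (flip s)))
        ≡⟨ weighted-sum part counts (λ j → lb (B j (flip s))) ⟨
      sum (λ j → lb (B j (flip s)) * N j) ∎)
      where
      open ≤-Reasoning
      exact : ∀ v → isAtLeast (B (part v) (flip s)) ≡ 0
      exact = sum≡0⇒≡0 (λ v → isAtLeast (B (part v) (flip s)))
                (trans (sym (weighted-sum part counts (λ j → isAtLeast (B j (flip s))))) ≡0)

    -- `blow-up` supplies the vertices. Kinds with `L q ≡ 0` are absent by `Within` and all others
    -- are frequent, as `realize` demands.
    large-balanced⇒Reg : {L : Fin (σ + σ) → ℕ} {B : Fin m → Req} → Bounded B → Within L B →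
                         ∀ {N} → Large L B N → Balanced B N → Reg B N
    large-balanced⇒Reg {L = L} {B} bounded within {N} large balance
      with k , part , counts ← blow-up N
      = reg part counts (realize (B ∘ part) Δ (bounded ∘ part)
          (λ s → of-kind (s ↑ˡ σ) (λ v → kind-W s (B (part v))))
          (λ s → of-kind (σ ↑ʳ s) (λ v → kind-U s (B (part v))))
          (λ s → Sum.map
            (λ le → subst (_≤ sum (λ v → lb (B (part v) (flip s)))) (weighted-sum part counts (λ j → lb (B j s)))
                      (subst (sum (λ j → lb (B j s) * N j) ≤_) (weighted-sum part counts (λ j → lb (B j (flip s)))) le))
            (subst (1 ≤_) (weighted-sum part counts (λ j → isAtLeast (B j (flip s)))))
            (balance s)))
      where
      of-kind : ∀ q {g : Fin k → ℕ} → (∀ v → kind q (B (part v)) ≡ g v) → sum g ≡ 0 ⊎ threshold Δ ≤ sum g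
      of-kind q eq with large q
      ... | inj₁ L≡0 = inj₁ (sum-zero λ v → trans (sym (eq v)) (n≤0⇒n≡0 (≤-trans (within q (part v)) (≤-reflexive L≡0))))
      ... | inj₂ big = inj₂ (subst (threshold Δ ≤_) (trans (weighted-sum part counts (λ j → kind q (B j))) (sum-cong-≗ eq)) big)

    -- If all kinds with positive `L` are frequent, balance decides. Otherwise one of them has at
    -- most `threshold Δ` vertices, and `few-≬` reduces to `except q L`, whose sum is smaller.
    -- Removal only lowers bounds, so `Δ`, and with it the threshold, stays fixed.
    definable-within : ∀ n (L : Fin (σ + σ) → ℕ) → sum L < n →
                       ∀ {m} (B : Fin m → Req) → Bounded B → Within L B → Sandwich (Reg B) (Reg B)
    definable-within (suc n) L (s≤s ΣL≤n) {m} B bounded within = weaken to from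
      (∨-≬ (∧-≬ large-≬ balanced-≬) (⋁-≬ small-≬))
      where
      large-≬ : Sandwich (Large L B) (Large L B)
      large-≬ = ⋀-≬ λ q → ∨-≬ (const-≬ (L q ℕ.≟ 0)) (≤-≬ (num-lin (threshold Δ)) (Σ-lin (λ j → kind q (B j)) id))
      balanced-≬ : Sandwich (Balanced B) (Balanced B)
      balanced-≬ = ⋀-≬ λ s → ∨-≬ (≤-≬ (Σ-lin (λ j → lb (B j s)) id) (Σ-lin (λ j → lb (B j (flip s))) id))
                                 (≤-≬ (num-lin 1) (Σ-lin (λ j → isAtLeast (B j (flip s))) id))
      small-≬ : ∀ q → Sandwich (λ N → 0 < L q × Reg≤ q (threshold Δ) B N) (Reg B)
      small-≬ q with >0⊎≡0 (L q)
      -- An exhausted kind contributes a false disjunct, which keeps the recursive call to kinds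
      -- that lower `sum L`.
      ... | inj₂ L≡0 = sandwich ⊥′ (λ { N (L>0 , _) → contradiction (subst (0 <_) L≡0 L>0) λ () }) (λ N → ⊥-elim)
      ... | inj₁ L>0 = weaken (λ N → proj₂) (λ N → id)
        (few-≬ L q (definable-within n (except q L) (<-≤-trans (sum-except q L L>0) ΣL≤n)) (threshold Δ) B bounded within)
      to : ∀ N → Reg B N → (Large L B N × Balanced B N) ⊎ Σ (Fin (σ + σ)) λ q → 0 < L q × Reg≤ q (threshold Δ) B N
      to N r = Sum.map₁ (_, balanced r) (all-or-some classify)
        where
        classify : ∀ q → (L q ≡ 0 ⊎ threshold Δ ≤ sum (λ j → kind q (B j) * N j)) ⊎ (0 < L q × Reg≤ q (threshold Δ) B N)
        classify q with >0⊎≡0 (L q) | ≤-total (threshold Δ) (sum (λ j → kind q (B j) * N j))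
        ... | inj₂ L≡0 | _ = inj₁ (inj₁ L≡0)
        ... | inj₁ _ | inj₁ big = inj₁ (inj₂ big)
        ... | inj₁ L>0 | inj₂ few =
          inj₂ (L>0 , r , subst (_≤ threshold Δ) (weighted-sum (part r) (counts r) (λ j → kind q (B j))) few)
      from : ∀ N → (Large L B N × Balanced B N) ⊎ Σ (Fin (σ + σ)) (λ q → Reg B N) → Reg B N
      from N (inj₁ (large , balance)) = large-balanced⇒Reg bounded within large balance
      from N (inj₂ (_ , r)) = r

  -- Crude initial bounds suffice: all lower bounds together for `Δ`, and the number of parts of
  -- kind `q` for `L q`.
  definable : (B : Fin m → Req) → Sandwich (Reg B) (Reg B)
  definable B = definable-within (sum (λ j → sum (λ s → lb (B j s)))) (suc (sum L)) L ≤-refl B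
    (term≤sum (λ j → sum (λ s → lb (B j s))))
    (λ q j → term≤sum (λ j → kind q (B j)) j)
    where
    L : Fin (σ + σ) → ℕ
    L q = sum (λ j → kind q (B j))

-- Digraphs as labelled graphs

count≡sum : ∀ k (p : Fin k → Bool) → count k p ≡ sum (λ v → if p v then 1 else 0)
count≡sum zero p = refl
count≡sum (suc k) p = cong ((if p zero then 1 else 0) +_) (count≡sum k (p ∘ suc))

module Digraphs (ℓ : ℕ) where

  out inc : Fin ℓ → Fin (ℓ + ℓ)
  out i = i ↑ˡ ℓ
  inc i = ℓ ↑ʳ i

  reverse : Fin (ℓ + ℓ) → Fin (ℓ + ℓ)
  reverse s = join ℓ ℓ (Sum.swap (splitAt ℓ s))

  reverse-out : ∀ i → reverse (out i) ≡ inc i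
  reverse-out i = cong (join ℓ ℓ ∘ Sum.swap) (splitAt-↑ˡ ℓ i ℓ)

  splitAt-reverse : ∀ s → splitAt ℓ (reverse s) ≡ Sum.swap (splitAt ℓ s)
  splitAt-reverse s = splitAt-join ℓ ℓ (Sum.swap (splitAt ℓ s))

  reverse-reverse : ∀ s → reverse (reverse s) ≡ s
  reverse-reverse s = trans (cong (join ℓ ℓ) (trans (cong Sum.swap (splitAt-reverse s)) (swap-involutive (splitAt ℓ s))))
                            (join-splitAt ℓ ℓ s)

  reverse≢ : ∀ s → reverse s ≢ s
  reverse≢ s eq = swap≢ (splitAt ℓ s) (trans (sym (splitAt-reverse s)) (cong (splitAt ℓ) eq))
    where
    swap≢ : (x : Fin ℓ ⊎ Fin ℓ) → Sum.swap x ≢ x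
    swap≢ (inj₁ _) ()
    swap≢ (inj₂ _) ()

  out≢inc : ∀ i i′ → out i ≢ inc i′
  out≢inc i i′ eq with () ← trans (sym (splitAt-↑ˡ ℓ i ℓ)) (trans (cong (splitAt ℓ) eq) (splitAt-↑ʳ ℓ ℓ i′))

  open Labelled reverse reverse-reverse reverse≢

  -- From digraphs to labelled graphs

  module _ {k} (G : Digraph ℓ k) where
    open Digraph G

    Joined : Fin k → Fin k → Set
    Joined u v = Σ (Fin ℓ) λ i → E i u v ≡ true

    joined? : ∀ u v → Dec (Joined u v)
    joined? u v = any? λ i → E i u v Bool.≟ true

    -- Disjointness makes the colour found by the search the only one, and asymmetry excludes two
    -- positive answers, so giving the first precedence loses no edge.
    orient : ∀ {u v} → Dec (Joined u v) → Dec (Joined v u) → Label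
    orient (yes (i , _)) _ = just (out i)
    orient (no _) (yes (i , _)) = just (inc i)
    orient (no _) (no _) = nothing

    orient-symm : ∀ {u v} (d : Dec (Joined u v)) (d′ : Dec (Joined v u)) → orient d′ d ≡ map reverse (orient d d′)
    orient-symm (yes (i , e)) (yes (i′ , e′)) = contradiction (trans (sym e′) (asym i i′ _ _ e)) λ ()
    orient-symm (yes (i , _)) (no _) = cong just (sym (reverse-out i))
    orient-symm (no _) (yes (i , _)) = cong just (trans (sym (reverse-reverse (out i))) (cong reverse (reverse-out i)))
    orient-symm (no _) (no _) = refl

    orient-irrefl : ∀ {v} (d d′ : Dec (Joined v v)) → orient d d′ ≡ nothing
    orient-irrefl (yes (i , e)) _ = contradiction (trans (sym e) (irrefl i _)) λ ()
    orient-irrefl (no _) (yes (i , e)) = contradiction (trans (sym e) (irrefl i _)) λ ()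
    orient-irrefl (no _) (no _) = refl

    toGraph : Graph k
    toGraph = record
      { label = λ u v → orient (joined? u v) (joined? v u)
      ; irrefl = λ v → orient-irrefl (joined? v v) (joined? v v)
      ; symm = λ u v → orient-symm (joined? u v) (joined? v u) }

    hit-orient : ∀ i {u v} (d : Dec (Joined u v)) (d′ : Dec (Joined v u)) →
                 hit (out i) (orient d d′) ≡ (if E i u v then 1 else 0)
    hit-orient i {u} {v} (yes (i′ , e′)) _ with E i u v in e
    ... | true = trans (cong (λ z → δ (out i) (out z)) (disjoint i′ i u v e′ e)) (δ-refl (out i))
    ... | false = δ-≢ λ eq → contradiction (trans (sym e′) (trans (cong (λ z → E z u v) (sym (↑ˡ-injective ℓ i i′ eq))) e)) λ ()
    hit-orient i {u} {v} (no ¬e) d′ with E i u v in e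
    hit-orient i {u} {v} (no ¬e) d′ | true = contradiction (i , e) ¬e
    hit-orient i {u} {v} (no ¬e) (yes (i′ , _)) | false = δ-≢ (out≢inc i i′)
    hit-orient i {u} {v} (no ¬e) (no _) | false = refl

    out-deg≡ : ∀ i v → out-deg G i v ≡ deg toGraph (out i) v
    out-deg≡ i v = trans (count≡sum k (E i v)) (sum-cong-≗ λ w → sym (hit-orient i (joined? v w) (joined? w v)))

    in-deg≡ : ∀ i v → in-deg G i v ≡ deg toGraph (inc i) v
    in-deg≡ i v = trans (count≡sum k (λ u → E i u v)) (sum-cong-≗ λ u → sym (begin
      hit (inc i) (Graph.label toGraph v u)
        ≡⟨ cong₂ hit (sym (reverse-out i)) (Graph.symm toGraph u v) ⟩
      hit (reverse (out i)) (map reverse (Graph.label toGraph u v))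
        ≡⟨ hit-flip (out i) (Graph.label toGraph u v) ⟩
      hit (out i) (Graph.label toGraph u v)
        ≡⟨ hit-orient i (joined? u v) (joined? v u) ⟩
      (if E i u v then 1 else 0) ∎))
      where open ≡-Reasoning

  -- From labelled graphs to digraphs

  has : Fin (ℓ + ℓ) → Label → Bool
  has s nothing = false
  has s (just t) = ⌊ s ≟ t ⌋

  hit≡has : ∀ s x → hit s x ≡ (if has s x then 1 else 0)
  hit≡has s nothing = refl
  hit≡has s (just t) = refl

  has-true : ∀ {s} x → has s x ≡ true → x ≡ just s
  has-true {s} (just t) h with s ≟ t
  ... | yes refl = refl

  module _ {k} (G : Graph k) where
    open Graph G

    reversed : ∀ i u v → has (out i) (label u v) ≡ true → label v u ≡ just (inc i)
    reversed i u v h = trans (symm u v) (trans (cong (map reverse) (has-true (label u v) h)) (cong just (reverse-out i)))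

    -- Only outgoing slots are read as edges. Disjointness holds because a pair has one label,
    -- asymmetry because the reverse of an outgoing slot is an incoming one.
    fromGraph : Digraph ℓ k
    fromGraph = record
      { E = λ i u v → has (out i) (label u v)
      ; irrefl = λ i v → cong (has (out i)) (irrefl v)
      ; disjoint = λ i i′ u v h h′ → ↑ˡ-injective ℓ i i′
          (just-injective (trans (sym (has-true (label u v) h)) (has-true (label u v) h′)))
      ; asym = λ i i′ u v h → trans (cong (has (out i′)) (reversed i u v h)) (not-out i i′) }
      where
      not-out : ∀ i i′ → ⌊ out i′ ≟ inc i ⌋ ≡ false
      not-out i i′ with out i′ ≟ inc i
      ... | yes eq = contradiction eq (out≢inc i′ i)
      ... | no _ = refl

    out-deg-from : ∀ i v → out-deg fromGraph i v ≡ deg G (out i) v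
    out-deg-from i v = trans (count≡sum k _) (sum-cong-≗ λ w → sym (hit≡has (out i) (label v w)))

    in-deg-from : ∀ i v → in-deg fromGraph i v ≡ deg G (inc i) v
    in-deg-from i v = trans (count≡sum k _) (sum-cong-≗ λ u → begin
      (if has (out i) (label u v) then 1 else 0)     ≡⟨ hit≡has (out i) (label u v) ⟨
      hit (out i) (label u v)                        ≡⟨ hit-flip (out i) (label u v) ⟨
      hit (reverse (out i)) (map reverse (label u v)) ≡⟨ cong₂ hit (sym (reverse-out i)) (symm u v) ⟨
      hit (inc i) (label v u)                        ∎)
      where open ≡-Reasoning

  module _ {m} (C D : Fin ℓ → Fin m → 𝔹) where

    requirement : Fin m → Req
    requirement j s = [ (λ i → D i j) , (λ i → C i j) ]′ (splitAt ℓ s)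

    requirement-out : ∀ i j → requirement j (out i) ≡ D i j
    requirement-out i j = cong [ (λ i → D i j) , (λ i → C i j) ]′ (splitAt-↑ˡ ℓ i ℓ)

    requirement-inc : ∀ i j → requirement j (inc i) ≡ C i j
    requirement-inc i j = cong [ (λ i → D i j) , (λ i → C i j) ]′ (splitAt-↑ʳ ℓ ℓ i)

    to-Reg : ∀ {N} → ∃RegularOfSize C D N → Reg requirement N
    to-Reg (k , G , part , sizes , ins , outs) =
      reg part (λ j → trans (sym (count≡sum k _)) (sizes j)) (toGraph G , degs)
      where
      degs : ∀ v s → deg (toGraph G) s v ≐ requirement (part v) s
      degs v s with splitAt ℓ s in eq
      ... | inj₁ i with refl ← splitAt⁻¹-↑ˡ eq = subst (_≐ D i (part v)) (out-deg≡ G i v) (outs i v)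
      ... | inj₂ i with refl ← splitAt⁻¹-↑ʳ {ℓ} eq = subst (_≐ C i (part v)) (in-deg≡ G i v) (ins i v)

    from-Reg : ∀ {N} → Reg requirement N → ∃RegularOfSize C D N
    from-Reg (reg {k} part counts (G , degs)) =
      k , fromGraph G , part , (λ j → trans (count≡sum k _) (counts j)) ,
      (λ i v → subst (in-deg (fromGraph G) i v ≐_) (requirement-inc i (part v))
                 (subst (_≐ requirement (part v) (inc i)) (sym (in-deg-from G i v)) (degs v (inc i)))) ,
      (λ i v → subst (out-deg (fromGraph G) i v ≐_) (requirement-out i (part v))
                 (subst (_≐ requirement (part v) (out i)) (sym (out-deg-from G i v)) (degs v (out i))))

theorem5 : (ℓ m : ℕ) (C D : Fin ℓ → Fin m → 𝔹) →
    Σ (Formula m) (λ REG → (N : Fin m → ℕ) → (∃RegularOfSize C D N ⇔ ⟦ REG ⟧ N))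
theorem5 ℓ m C D =
  Sandwich.formula S , λ N → mk⇔ (Sandwich.complete S N ∘ to-Reg C D) (from-Reg C D ∘ Sandwich.sound S N)
  where
  open Digraphs ℓ
  open Labelled reverse reverse-reverse reverse≢
  S : Sandwich (Reg (requirement C D)) (Reg (requirement C D))
  S = definable (requirement C D)
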